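{- Let $V$ be a dataset of $n$ elements of a metric space $(U,d)$, let $\mathcal{C}$ be a $k$-clustering of $V$, and let $\varepsilon,\delta\in(0,1)$. Let $e_{(1)},\dots,e_{(m)}$ be $m$ elements sampled independently and uniformly at random from $V$, and let $\widehat{s}_1(\mathcal{C})=\frac1m\sum_{\ell=1}^m s(e_{(\ell)})$. If $m\ge\frac{2}{\varepsilon^2}\ln\frac{2}{\delta}$, then $|\widehat{s}_1(\mathcal{C})-s(\mathcal{C})|\le\varepsilon$ with probability at least $1-\delta$, where $s(\mathcal{C})$ is the silhouette of the clustering $\mathcal{C}$.
   Context: A dataset is a finite set $V=\{e_1,\dots,e_n\}\subseteq U$ of $n$ distinct elements of a metric space $(U,d)$. A $k$-clustering $\mathcal{C}=\{C_1,\dots,C_k\}$ of $V$ is a partition of $V$ into $k$ disjoint nonempty subsets (clusters); here $k\ge 2$. For $e\in V$ belonging to cluster $C$ with $|C|\ge 2$, let $a(e)=\frac{1}{|C|-1}\sum_{e'\in C}d(e,e')$ and $b(e)=\min_{C_j\in\mathcal{C},\,C_j\ne C}\frac{1}{|C_j|}\sum_{e'\in C_j}d(e,e')$. The silhouette of $e$ is $s(e)=\frac{b(e)-a(e)}{\max\{a(e),b(e)\}}$; if $C=\{e\}$, then $s(e)=0$. The silhouette of the clustering is $s(\mathcal{C})=\frac1n\sum_{i=1}^n s(e_i)$. -}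

module Defs where

open import Algebra.Bundles using (CommutativeRing; Semiring)
import Algebra.Construct.NaturalChoice.Max as Max
import Algebra.Construct.NaturalChoice.Min as Min
import Algebra.Definitions.RawSemiring as RawSemiringDefs
open import Data.Bool.Base using (if_then_else_)
open import Data.Fin.Base using (Fin; finToFun; toℕ)
open import Data.Fin.Subset using (Subset; _∈_; _∩_; Nonempty; Empty; ∣_∣)
open import Data.Fin.Subset.Properties using (_∈?_)
open import Data.Nat.Base as ℕ using (ℕ; suc; z≤n; s≤s; _∸_; _!)
import Data.Nat.Properties as ℕ
open import Data.Product.Base using (∃; _×_; proj₁)
open import Data.Vec.Functional using (Vector; foldr; head; tail; removeAt)
open import Function.Definitions using (Injective)
open import Function.Metric.Structures using (IsGeneralMetric)
open import Level using () renaming (suc to lsuc; _⊔_ to _⊔ˡ_)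
open import Relation.Binary.Bundles using (DecTotalOrder)
import Relation.Binary.Construct.NonStrictToStrict as Strict
open import Relation.Binary.Core using (Rel)
open import Relation.Binary.PropositionalEquality.Core using (_≡_; _≢_)
open import Relation.Binary.Structures using (IsDecTotalOrder)
open import Relation.Nullary using (¬_; does; yes; no)
open import Relation.Unary using (Pred; Decidable)

-- The real numbers, characterised up to isomorphism as a Dedekind-complete
-- ordered field.  Equality is a setoid equality, so that sequences or cuts may
-- serve as carrier; the order is decidable, i.e. the reals are the classical
-- ones.
record Reals c ℓ₁ ℓ₂ : Set (lsuc (c ⊔ˡ ℓ₁ ⊔ˡ ℓ₂)) where
  field
    commutativeRing : CommutativeRing c ℓ₁

  open CommutativeRing commutativeRing public

  infix 4 _≤_

  field
    _≤_             : Rel Carrier ℓ₂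
    isDecTotalOrder : IsDecTotalOrder _≈_ _≤_
    0≉1             : ¬ 0# ≈ 1#
    invertible      : ∀ x → ¬ x ≈ 0# → ∃ λ y → x * y ≈ 1#
    +-monoˡ-≤       : ∀ z {x y} → x ≤ y → x + z ≤ y + z
    *-nonneg        : ∀ {x y} → 0# ≤ x → 0# ≤ y → 0# ≤ x * y

  UpperBound : Pred Carrier (c ⊔ˡ ℓ₁ ⊔ˡ ℓ₂) → Pred Carrier (c ⊔ˡ ℓ₁ ⊔ˡ ℓ₂)
  UpperBound P u = ∀ {x} → P x → x ≤ u

  field
    complete : ∀ P → ∃ P → ∃ (UpperBound P) →
               ∃ λ s → UpperBound P s × (∀ {u} → UpperBound P u → s ≤ u)

  decTotalOrder : DecTotalOrder c ℓ₁ ℓ₂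
  decTotalOrder = record { isDecTotalOrder = isDecTotalOrder }

  open DecTotalOrder decTotalOrder public
    using (_≤?_; _≟_; totalOrder)

  open Strict _≈_ _≤_ public using (_<_)
  open Max totalOrder public using (_⊔_)
  open Min totalOrder public using (_⊓_)
  open RawSemiringDefs (Semiring.rawSemiring semiring) public
    using (sum; product; _^_) renaming (_×_ to _·_)

  infixl 7 _/_

  fromℕ : ℕ → Carrier
  fromℕ n = n · 1#

  -- Total inverse and division, with the convention 0⁻¹ = 0.
  _⁻¹ : Carrier → Carrier
  x ⁻¹ with x ≟ 0#
  ... | yes _  = 0#
  ... | no x≉0 = proj₁ (invertible x x≉0)

  _/_ : Carrier → Carrier → Carrier
  x / y = x * y ⁻¹

  abs : Carrier → Carrier
  abs x = x ⊔ (- x)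

  minimum : ∀ {n} → Vector Carrier (suc n) → Carrier
  minimum f = foldr _⊓_ (head f) (tail f)

  _ConvergesTo_ : (ℕ → Carrier) → Carrier → Set (c ⊔ˡ ℓ₁ ⊔ˡ ℓ₂)
  f ConvergesTo l = ∀ η → 0# < η → ∃ λ N → ∀ i → N ℕ.≤ i → abs (f i - l) ≤ η

  -- Sum of x ^ i / i ! over i < N.
  expPartialSum : Carrier → ℕ → Carrier
  expPartialSum x N = sum {N} λ i → x ^ toℕ i / fromℕ (toℕ i !)

  -- exp x = y, with exp the sum of its power series
  IsExp : Carrier → Carrier → Set (c ⊔ˡ ℓ₁ ⊔ˡ ℓ₂)
  IsExp x y = expPartialSum x ConvergesTo y

  -- ln y = x
  IsLn : Carrier → Carrier → Set (c ⊔ˡ ℓ₁ ⊔ˡ ℓ₂)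
  IsLn y x = IsExp x y

-- A k-clustering of a dataset indexed by Fin n, with clusters given as sets of
-- indices.
record Clustering (n k : ℕ) : Set where
  field
    2≤k      : 2 ℕ.≤ k
    cluster  : Fin k → Subset n
    nonempty : ∀ j → Nonempty (cluster j)
    disjoint : ∀ {i j} → i ≢ j → Empty (cluster i ∩ cluster j)
    covers   : ∀ e → ∃ λ j → e ∈ cluster j

  clusterOf : Fin n → Fin k
  clusterOf e = proj₁ (covers e)

module _ {c ℓ₁ ℓ₂} (ℝ : Reals c ℓ₁ ℓ₂) where

  open Reals ℝ

  record MetricSpace u ℓ : Set (lsuc (u ⊔ˡ ℓ) ⊔ˡ c ⊔ˡ ℓ₁ ⊔ˡ ℓ₂) where
    field
      Point    : Set u
      _≈ₚ_     : Rel Point ℓ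
      d        : Point → Point → Carrier
      isMetric : IsGeneralMetric _≈ₚ_ _≈_ _≤_ 0# _+_ d

  record Dataset {u ℓ} (U : MetricSpace u ℓ) (n : ℕ) : Set (u ⊔ˡ ℓ) where
    open MetricSpace U
    field
      element  : Fin n → Point
      distinct : Injective _≡_ _≈ₚ_ element

  module Silhouette {u ℓ} {U : MetricSpace u ℓ} {n k}
                    (V : Dataset U n) (𝒞 : Clustering n k) where
    open MetricSpace U
    open Dataset V
    open Clustering 𝒞

    distanceSum : Fin n → Subset n → Carrier
    distanceSum e C =
      sum λ e′ → if does (e′ ∈? C) then d (element e) (element e′) else 0#

    a : Fin n → Carrier
    a e = distanceSum e C / fromℕ (∣ C ∣ ∸ 1)
      where C = cluster (clusterOf e)

    -- Minimum of f over the indices other than j.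
    minimumOthers : ∀ {k} → 2 ℕ.≤ k → Vector Carrier k → Fin k → Carrier
    minimumOthers (s≤s (s≤s z≤n)) f j = minimum (removeAt f j)

    b : Fin n → Carrier
    b e = minimumOthers 2≤k
            (λ j → distanceSum e (cluster j) / fromℕ ∣ cluster j ∣)
            (clusterOf e)

    s : Fin n → Carrier
    s e = if does (2 ℕ.≤? ∣ cluster (clusterOf e) ∣)
          then (b e - a e) / (a e ⊔ b e)
          else 0#

    silhouette : Carrier
    silhouette = sum s / fromℕ n

    estimate : ∀ {m} → (Fin m → Fin n) → Carrier
    estimate {m} ω = sum (λ l → s (ω l)) / fromℕ m

  uniform : ∀ n → Vector Carrier n
  uniform n _ = 1# / fromℕ n

  -- Probability, for m independent draws from the mass function p on Fin n, that
  -- the outcome ω satisfies P: the sum over all such ω of the product of the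
  -- masses p (ω l).  The function finToFun enumerates Fin m → Fin n.
  Pr : ∀ {n} (p : Vector Carrier n) m {q} {P : Pred (Fin m → Fin n) q} →
       Decidable P → Carrier
  Pr {n} p m P? = sum {n ℕ.^ m} λ t →
    let ω = finToFun {n} {m} t in
    if does (P? ω) then product (λ l → p (ω l)) else 0#

{-# OPTIONS --safe #-}

-- Hoeffding's inequality for the draws X = s (ω l) ∈ [-1, 1], proved with (1 + t / k) ^ k
-- in place of exp t and k → ∞ at the very end.
--
-- Put Y = X - E X and h = ε / k.  Under the weights w j = p (1 + h Y) ^ j the mean of Y
-- grows by at most h per step, because the variance of X is at most 1; summing the
-- drifts gives the moment bound E (1 + h Y) ^ k ≤ (1 + ε² / 2k) ^ k, with no error term.
-- On the tail event the product of the factors (1 + h Y) is at least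
-- 1 + mε² / k - O(1 / k²), so Markov's inequality for both tails gives
-- q (1 + L / k) ^ k ≤ 2 + O(1 / k) for the probability q of the bad event.  Comparing
-- the binomial expansion of (1 + L / k) ^ k with the exponential series turns this into
-- q exp L ≤ 2, that is q ≤ δ.

module Submission where

open import Defs
open import Algebra.Solver.Ring.AlmostCommutativeRing
  using (_-Raw-AlmostCommutative⟶_; fromCommutativeRing)
open import Data.Bool.Base using (if_then_else_; true; false)
open import Data.Empty using (⊥-elim)
open import Data.Fin.Base as Fin using (Fin; zero; suc; toℕ; finToFun; remQuot; splitAt)
import Data.Fin.Properties as Fin
open import Data.Fin.Subset using (∣_∣)
open import Data.Fin.Subset.Properties using (_∈?_)
open import Data.Integer.Base as ℤ using (ℤ; +_; -[1+_])
import Data.Integer.Properties as ℤ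
open import Data.Maybe.Base using (map)
open import Data.Nat.Base as ℕ using (ℕ; zero; suc; s≤s; z≤n; _!)
open import Data.Nat.Combinatorics using (_C_; nCk≡n!/k![n-k]!)
open import Data.Nat.Combinatorics.Base using (_P′_; _C′_)
open import Data.Nat.Combinatorics.Specification using (nC′k≡n!/k![n-k]!; k!∣nP′k)
open import Data.Nat.DivMod using (m/n*n≡m)
import Data.Nat.Properties as ℕ
open import Data.Nat.Tactic.RingSolver using (solve-∀)
open import Data.Product.Base using (∃; _×_; _,_; proj₁; proj₂)
open import Data.Sum.Base using (_⊎_; inj₁; inj₂; [_,_]′)
open import Data.Vec.Functional using (Vector; foldr)
open import Function.Metric.Structures using (IsGeneralMetric)
open import Level as Level using (Lift; lift)
open import Relation.Binary.Bundles using (DecTotalOrder)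
open import Relation.Binary.PropositionalEquality as ≡ using (_≡_)
open import Relation.Nullary using (¬_; yes; no; does)
open import Relation.Nullary.Decidable using (dec⇒maybe)
open import Relation.Unary using (Pred; Decidable)

-- The exponential occurs only as a convergence statement about one given number, so neither its
-- functional equation nor its monotonicity or convexity is at hand. Integer powers of `1 + t / k`
-- multiply exactly, and everything before the limit is a polynomial inequality over an ordered
-- field, certified by a ring identity or by Bernoulli's inequality. The value `t = ε` minimises the
-- Chernoff exponent `m t² / 2 − m t ε` for variables of variance proxy 1. The drift argument is the
-- discrete form of the usual proof of Hoeffding's lemma: the second derivative of the logarithm of
-- the moment generating function is the variance under the tilted law, here the law proportional to
-- `w j`. The limit is taken by contradiction: completeness yields Archimedean indices only under a
-- double negation, which the decidable order removes from inequalities.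

-- A ring solver with integer coefficients.

module RealProperties {c ℓ₁ ℓ₂} (ℝ : Reals c ℓ₁ ℓ₂) where

  open Reals ℝ
  open DecTotalOrder decTotalOrder public using (poset; total)
    renaming (refl to ≤-refl; reflexive to ≤-reflexive; trans to ≤-trans; antisym to ≤-antisym)

  open import Algebra.Properties.Ring ring using (-‿involutive; -0#≈0#; -‿+-comm; -‿distribˡ-*; -‿distribʳ-*)
  open import Algebra.Properties.Semiring.Mult.TCOptimised semiring
    using (×-homo-+; ×1-homo-*) renaming (_×_ to _×′_)
  open import Relation.Binary.Reasoning.Setoid setoid

  -- Ring solver coefficients: over ℤ, unlike over the carrier, cancellation is decided
  -- by computation.
  ℤ⟦_⟧ : ℤ → Carrier
  ℤ⟦ + n ⟧      = n ×′ 1#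
  ℤ⟦ -[1+ n ] ⟧ = - (suc n ×′ 1#)

  ℤ⟦⟧-neg : ∀ i → ℤ⟦ ℤ.- i ⟧ ≈ - ℤ⟦ i ⟧
  ℤ⟦⟧-neg (+ zero)  = sym -0#≈0#
  ℤ⟦⟧-neg (+ suc n) = refl
  ℤ⟦⟧-neg -[1+ n ]  = sym (-‿involutive _)

  ℤ⟦⟧-⊖ : ∀ m n → ℤ⟦ m ℤ.⊖ n ⟧ ≈ m ×′ 1# - n ×′ 1#
  ℤ⟦⟧-⊖ m zero = begin
    m ×′ 1#         ≈⟨ +-identityʳ _ ⟨
    m ×′ 1# + 0#    ≈⟨ +-congˡ -0#≈0# ⟨
    m ×′ 1# - 0#    ∎
  ℤ⟦⟧-⊖ zero (suc n) = sym (+-identityˡ _)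
  ℤ⟦⟧-⊖ (suc m) (suc n) = begin
    ℤ⟦ suc m ℤ.⊖ suc n ⟧                       ≡⟨ ≡.cong ℤ⟦_⟧ (ℤ.[1+m]⊖[1+n]≡m⊖n m n) ⟩
    ℤ⟦ m ℤ.⊖ n ⟧                               ≈⟨ ℤ⟦⟧-⊖ m n ⟩
    m ×′ 1# - n ×′ 1#                          ≈⟨ +-congʳ (+-identityˡ _) ⟨
    (0# + m ×′ 1#) - n ×′ 1#                   ≈⟨ +-congʳ (+-congʳ (-‿inverseʳ 1#)) ⟨
    ((1# - 1#) + m ×′ 1#) - n ×′ 1#            ≈⟨ +-congʳ (+-assoc _ _ _) ⟩
    (1# + (- 1# + m ×′ 1#)) - n ×′ 1#          ≈⟨ +-congʳ (+-congˡ (+-comm _ _)) ⟩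
    (1# + (m ×′ 1# - 1#)) - n ×′ 1#            ≈⟨ +-congʳ (+-assoc _ _ _) ⟨
    ((1# + m ×′ 1#) - 1#) - n ×′ 1#            ≈⟨ +-assoc _ _ _ ⟩
    (1# + m ×′ 1#) + (- 1# - n ×′ 1#)          ≈⟨ +-cong (×-homo-+ 1# 1 m) (trans (-‿cong (×-homo-+ 1# 1 n)) (sym (-‿+-comm _ _))) ⟨
    suc m ×′ 1# - suc n ×′ 1#                  ∎

  ℤ⟦⟧-+ : ∀ i j → ℤ⟦ i ℤ.+ j ⟧ ≈ ℤ⟦ i ⟧ + ℤ⟦ j ⟧
  ℤ⟦⟧-+ (+ m)    (+ n)    = ×-homo-+ 1# m n
  ℤ⟦⟧-+ (+ m)    -[1+ n ] = ℤ⟦⟧-⊖ m (suc n)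
  ℤ⟦⟧-+ -[1+ m ] (+ n)    = trans (ℤ⟦⟧-⊖ n (suc m)) (+-comm _ _)
  ℤ⟦⟧-+ -[1+ m ] -[1+ n ] = begin
    - (suc (suc (m ℕ.+ n)) ×′ 1#)          ≡⟨ ≡.cong (λ k → - (suc k ×′ 1#)) (ℕ.+-suc m n) ⟨
    - ((suc m ℕ.+ suc n) ×′ 1#)            ≈⟨ -‿cong (×-homo-+ 1# (suc m) (suc n)) ⟩
    - (suc m ×′ 1# + suc n ×′ 1#)          ≈⟨ -‿+-comm _ _ ⟨
    - (suc m ×′ 1#) - suc n ×′ 1#          ∎

  ℤ⟦⟧-*-pos : ∀ i n → ℤ⟦ i ℤ.* + n ⟧ ≈ ℤ⟦ i ⟧ * ℤ⟦ + n ⟧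
  ℤ⟦⟧-*-pos (+ m) n = begin
    ℤ⟦ + m ℤ.* + n ⟧       ≡⟨ ≡.cong ℤ⟦_⟧ (ℤ.pos-* m n) ⟨
    (m ℕ.* n) ×′ 1#        ≈⟨ ×1-homo-* m n ⟩
    (m ×′ 1#) * (n ×′ 1#)  ∎
  ℤ⟦⟧-*-pos -[1+ m ] n = begin
    ℤ⟦ -[1+ m ] ℤ.* + n ⟧         ≡⟨ ≡.cong ℤ⟦_⟧ (ℤ.neg-distribˡ-* (+ suc m) (+ n)) ⟨
    ℤ⟦ ℤ.- (+ suc m ℤ.* + n) ⟧    ≈⟨ ℤ⟦⟧-neg (+ suc m ℤ.* + n) ⟩
    - ℤ⟦ + suc m ℤ.* + n ⟧        ≈⟨ -‿cong (ℤ⟦⟧-*-pos (+ suc m) n) ⟩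
    - ((suc m ×′ 1#) * (n ×′ 1#)) ≈⟨ -‿distribˡ-* _ _ ⟩
    - (suc m ×′ 1#) * (n ×′ 1#)   ∎

  ℤ⟦⟧-* : ∀ i j → ℤ⟦ i ℤ.* j ⟧ ≈ ℤ⟦ i ⟧ * ℤ⟦ j ⟧
  ℤ⟦⟧-* i (+ n)    = ℤ⟦⟧-*-pos i n
  ℤ⟦⟧-* i -[1+ n ] = begin
    ℤ⟦ i ℤ.* -[1+ n ] ⟧        ≡⟨ ≡.cong ℤ⟦_⟧ (ℤ.neg-distribʳ-* i (+ suc n)) ⟨
    ℤ⟦ ℤ.- (i ℤ.* + suc n) ⟧   ≈⟨ ℤ⟦⟧-neg (i ℤ.* + suc n) ⟩
    - ℤ⟦ i ℤ.* + suc n ⟧       ≈⟨ -‿cong (ℤ⟦⟧-*-pos i (suc n)) ⟩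
    - (ℤ⟦ i ⟧ * (suc n ×′ 1#)) ≈⟨ -‿distribʳ-* _ _ ⟩
    ℤ⟦ i ⟧ * - (suc n ×′ 1#)   ∎

  ℤ⟦⟧-homomorphism : ℤ.+-*-rawRing -Raw-AlmostCommutative⟶ fromCommutativeRing commutativeRing
  ℤ⟦⟧-homomorphism = record
    { ⟦_⟧    = ℤ⟦_⟧
    ; +-homo = ℤ⟦⟧-+
    ; *-homo = ℤ⟦⟧-*
    ; -‿homo = ℤ⟦⟧-neg
    ; 0-homo = refl
    ; 1-homo = refl
    }

  open import Algebra.Solver.Ring ℤ.+-*-rawRing (fromCommutativeRing commutativeRing) ℤ⟦⟧-homomorphism
    (λ i j → map (λ i≡j → reflexive (≡.cong ℤ⟦_⟧ i≡j)) (dec⇒maybe (i ℤ.≟ j)))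
    public using (solve; _:=_; _:+_; _:*_; _:-_; :-_; con)

-- Arithmetic of a complete ordered field.

module OrderProperties {c ℓ₁ ℓ₂} (ℝ : Reals c ℓ₁ ℓ₂) where

  open Reals ℝ
  open RealProperties ℝ
  open import Algebra.Properties.Semiring.Mult semiring public using () renaming (×-homo-+ to ·-homo-+; ×1-homo-* to fromℕ-*)
  open import Algebra.Properties.Semiring.Exp semiring public using (^-congˡ; ^-assocʳ)
  open import Algebra.Properties.CommutativeSemiring.Exp commutativeSemiring public using (^-distrib-*)
  open import Relation.Binary.Reasoning.PartialOrder poset

  -- Reduces a polynomial inequality to a certificate: a difference that is visibly nonnegative, and
  -- an identity left to the ring solver.
  ≤-byDifference : ∀ {x y z} → 0# ≤ z → x + z ≈ y → x ≤ y
  ≤-byDifference {x} {y} {z} 0≤z x+z≈y = begin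
    x      ≈⟨ +-identityˡ x ⟨
    0# + x ≤⟨ +-monoˡ-≤ x 0≤z ⟩
    z + x  ≈⟨ +-comm z x ⟩
    x + z  ≈⟨ x+z≈y ⟩
    y      ∎

  x≤y⇒0≤y-x : ∀ {x y} → x ≤ y → 0# ≤ y - x
  x≤y⇒0≤y-x {x} {y} x≤y = begin
    0#    ≈⟨ -‿inverseʳ x ⟨
    x - x ≤⟨ +-monoˡ-≤ (- x) x≤y ⟩
    y - x ∎

  +-mono-≤ : ∀ {x y u v} → x ≤ y → u ≤ v → x + u ≤ y + v
  +-mono-≤ {x} {y} {u} {v} x≤y u≤v = begin
    x + u ≤⟨ +-monoˡ-≤ u x≤y ⟩
    y + u ≈⟨ +-comm y u ⟩
    u + y ≤⟨ +-monoˡ-≤ y u≤v ⟩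
    v + y ≈⟨ +-comm v y ⟩
    y + v ∎

  +-nonneg : ∀ {x y} → 0# ≤ x → 0# ≤ y → 0# ≤ x + y
  +-nonneg 0≤x 0≤y = ≤-trans (≤-reflexive (sym (+-identityˡ 0#))) (+-mono-≤ 0≤x 0≤y)

  -‿anti-≤ : ∀ {x y} → x ≤ y → - y ≤ - x
  -‿anti-≤ {x} {y} x≤y = ≤-byDifference (x≤y⇒0≤y-x x≤y) (solve 2 (λ x y → :- y :+ (y :- x) := :- x) refl x y)

  *-monoˡ-≤ : ∀ {z x y} → 0# ≤ z → x ≤ y → z * x ≤ z * y
  *-monoˡ-≤ {z} {x} {y} 0≤z x≤y = ≤-byDifference (*-nonneg 0≤z (x≤y⇒0≤y-x x≤y))
    (solve 3 (λ x y z → z :* x :+ z :* (y :- x) := z :* y) refl x y z)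

  *-monoʳ-≤ : ∀ {z x y} → 0# ≤ z → x ≤ y → x * z ≤ y * z
  *-monoʳ-≤ {z} {x} {y} 0≤z x≤y = begin
    x * z ≈⟨ *-comm x z ⟩
    z * x ≤⟨ *-monoˡ-≤ 0≤z x≤y ⟩
    z * y ≈⟨ *-comm z y ⟩
    y * z ∎

  *-mono-≤ : ∀ {x y u v} → 0# ≤ x → 0# ≤ u → x ≤ y → u ≤ v → x * u ≤ y * v
  *-mono-≤ 0≤x 0≤u x≤y u≤v = ≤-trans (*-monoʳ-≤ 0≤u x≤y) (*-monoˡ-≤ (≤-trans 0≤x x≤y) u≤v)

  square-nonneg : ∀ x → 0# ≤ x * x
  square-nonneg x with total 0# x
  ... | inj₁ 0≤x = *-nonneg 0≤x 0≤x
  ... | inj₂ x≤0 = ≤-trans (*-nonneg 0≤-x 0≤-x) (≤-reflexive (solve 1 (λ x → (con (+ 0) :- x) :* (con (+ 0) :- x) := x :* x) refl x))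
    where 0≤-x = x≤y⇒0≤y-x x≤0

  0≤1 : 0# ≤ 1#
  0≤1 = ≤-trans (square-nonneg 1#) (≤-reflexive (*-identityˡ 1#))

  1≰0 : ¬ 1# ≤ 0#
  1≰0 1≤0 = 0≉1 (≤-antisym 0≤1 1≤0)

  x≤1⇒x*y≤y : ∀ {x y} → 0# ≤ y → x ≤ 1# → x * y ≤ y
  x≤1⇒x*y≤y 0≤y x≤1 = ≤-trans (*-monoʳ-≤ 0≤y x≤1) (≤-reflexive (*-identityˡ _))

  ≰⇒≥ : ∀ {x y} → ¬ x ≤ y → y ≤ x
  ≰⇒≥ {x} {y} x≰y with total x y
  ... | inj₁ x≤y = ⊥-elim (x≰y x≤y)
  ... | inj₂ y≤x = y≤x

  -- The bridge from `archimedean`, whose index exists only under a double negation, to goals that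
  -- are inequalities.
  ≤-stable : ∀ {x y} → ¬ ¬ x ≤ y → x ≤ y
  ≤-stable {x} {y} ¬¬x≤y with x ≤? y
  ... | yes x≤y = x≤y
  ... | no  x≰y = ⊥-elim (¬¬x≤y x≰y)

  <⇒≱ : ∀ {x y} → x < y → ¬ y ≤ x
  <⇒≱ (x≤y , x≉y) y≤x = x≉y (≤-antisym x≤y y≤x)

  ≰⇒> : ∀ {x y} → ¬ x ≤ y → y < x
  ≰⇒> x≰y = ≰⇒≥ x≰y , λ y≈x → x≰y (≤-reflexive (sym y≈x))

  ⁻¹-inverseʳ : ∀ {x} → ¬ x ≈ 0# → x * x ⁻¹ ≈ 1#
  ⁻¹-inverseʳ {x} x≉0 with x ≟ 0#
  ... | yes x≈0 = ⊥-elim (x≉0 x≈0)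
  ... | no  x≉0 = proj₂ (invertible x x≉0)

  0<⇒≉0 : ∀ {x} → 0# < x → ¬ x ≈ 0#
  0<⇒≉0 (_ , 0≉x) x≈0 = 0≉x (sym x≈0)

  ⁻¹-inverse : ∀ {x} → 0# < x → x * x ⁻¹ ≈ 1#
  ⁻¹-inverse 0<x = ⁻¹-inverseʳ (0<⇒≉0 0<x)

  -- The convention for the inverse of 0 settles that case, so quotients are nonnegative even where
  -- a denominator may vanish, as in `a` for a singleton cluster.
  ⁻¹-nonneg : ∀ {x} → 0# ≤ x → 0# ≤ x ⁻¹
  ⁻¹-nonneg {x} 0≤x with x ≟ 0#
  ... | yes _ = ≤-refl
  ... | no x≉0 with invertible x x≉0
  ...   | y , xy≈1 with total 0# y
  ...     | inj₁ 0≤y = 0≤y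
  ...     | inj₂ y≤0 = ⊥-elim (1≰0 (begin
    1#     ≈⟨ xy≈1 ⟨
    x * y  ≤⟨ *-monoˡ-≤ 0≤x y≤0 ⟩
    x * 0# ≈⟨ zeroʳ x ⟩
    0#     ∎))

  /-nonneg : ∀ {x y} → 0# ≤ x → 0# ≤ y → 0# ≤ x / y
  /-nonneg 0≤x 0≤y = *-nonneg 0≤x (⁻¹-nonneg 0≤y)

  *-cancelˡ-≤ : ∀ {z x y} → 0# < z → z * x ≤ z * y → x ≤ y
  *-cancelˡ-≤ {z} {x} {y} 0<z zx≤zy = begin
    x               ≈⟨ undo x ⟨
    z ⁻¹ * (z * x)  ≤⟨ *-monoˡ-≤ (⁻¹-nonneg (proj₁ 0<z)) zx≤zy ⟩
    z ⁻¹ * (z * y)  ≈⟨ undo y ⟩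
    y               ∎
    where
    undo : ∀ w → z ⁻¹ * (z * w) ≈ w
    undo w = begin-equality
      z ⁻¹ * (z * w) ≈⟨ solve 3 (λ i z w → i :* (z :* w) := (z :* i) :* w) refl (z ⁻¹) z w ⟩
      (z * z ⁻¹) * w ≈⟨ *-congʳ (⁻¹-inverse 0<z) ⟩
      1# * w         ≈⟨ *-identityˡ w ⟩
      w              ∎

  *-pos : ∀ {x y} → 0# < x → 0# < y → 0# < x * y
  *-pos {x} {y} 0<x 0<y = ≰⇒> λ xy≤0 →
    <⇒≱ 0<y (*-cancelˡ-≤ 0<x (≤-trans xy≤0 (≤-reflexive (sym (zeroʳ x)))))

  ⁻¹-pos : ∀ {x} → 0# < x → 0# < x ⁻¹
  ⁻¹-pos {x} 0<x = ⁻¹-nonneg (proj₁ 0<x) , λ 0≈x⁻¹ → 0≉1 (begin-equality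
    0#       ≈⟨ zeroʳ x ⟨
    x * 0#   ≈⟨ *-congˡ 0≈x⁻¹ ⟩
    x * x ⁻¹ ≈⟨ ⁻¹-inverse 0<x ⟩
    1#       ∎)

  fromℕ-nonneg : ∀ n → 0# ≤ fromℕ n
  fromℕ-nonneg zero    = ≤-refl
  fromℕ-nonneg (suc n) = +-nonneg 0≤1 (fromℕ-nonneg n)

  fromℕ-+ : ∀ m n → fromℕ (m ℕ.+ n) ≈ fromℕ m + fromℕ n
  fromℕ-+ = ·-homo-+ 1#

  fromℕ-mono-≤ : ∀ {m n} → m ℕ.≤ n → fromℕ m ≤ fromℕ n
  fromℕ-mono-≤ {m} {n} m≤n = ≤-byDifference (fromℕ-nonneg (n ℕ.∸ m))
    (trans (sym (fromℕ-+ m (n ℕ.∸ m))) (reflexive (≡.cong fromℕ (ℕ.m+[n∸m]≡n m≤n))))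

  fromℕ-pos : ∀ n → 0# < fromℕ (suc n)
  fromℕ-pos n = ≰⇒> λ ≤0 → 1≰0 (≤-trans (≤-byDifference (fromℕ-nonneg n) refl) ≤0)

  fromℕ-^ : ∀ m n → fromℕ (m ℕ.^ n) ≈ fromℕ m ^ n
  fromℕ-^ m zero    = +-identityʳ 1#
  fromℕ-^ m (suc n) = trans (fromℕ-* m (m ℕ.^ n)) (*-congˡ (fromℕ-^ m n))

  -- Constructively the unboundedness of ℕ yields no index n with x ≤ fromℕ n,
  -- only the impossibility that there is none.
  archimedean : ∀ x → ¬ (∀ n → ¬ x ≤ fromℕ n)
  archimedean x unbounded
    with complete (λ y → Lift (c Level.⊔ ℓ₂) (∃ λ n → y ≈ fromℕ n)) (0# , lift (0 , refl))
           (x , λ { (lift (n , y≈n)) → ≤-trans (≤-reflexive y≈n) (≰⇒≥ (unbounded n)) })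
  ... | s , upper , least = 1≰0 (begin
    1#            ≈⟨ solve 1 (λ s → con (+ 1) := con (+ 1) :+ s :- s) refl s ⟩
    1# + s - s    ≤⟨ +-monoˡ-≤ (- s) 1+s≤s ⟩
    s - s         ≈⟨ -‿inverseʳ s ⟩
    0#            ∎)
    where
    -- With `n` also `suc n` is below `s`, so `s - 1#` is again an upper bound, against the
    -- minimality of `s`.
    s≤s-1 : s ≤ s - 1#
    s≤s-1 = least λ { {y} (lift (n , y≈n)) → begin
      y                ≈⟨ y≈n ⟩
      fromℕ n          ≈⟨ solve 1 (λ n → n := con (+ 1) :+ n :- con (+ 1)) refl (fromℕ n) ⟩
      fromℕ (suc n) - 1# ≤⟨ +-monoˡ-≤ (- 1#) (upper (lift (suc n , refl))) ⟩
      s - 1#           ∎ }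
    1+s≤s : 1# + s ≤ s
    1+s≤s = ≤-byDifference (x≤y⇒0≤y-x s≤s-1) (solve 1 (λ s → con (+ 1) :+ s :+ (s :- con (+ 1) :- s) := s) refl s)

  ^-nonneg : ∀ {x} n → 0# ≤ x → 0# ≤ x ^ n
  ^-nonneg zero    0≤x = 0≤1
  ^-nonneg (suc n) 0≤x = *-nonneg 0≤x (^-nonneg n 0≤x)

  ^-mono-≤ : ∀ {x y} n → 0# ≤ x → x ≤ y → x ^ n ≤ y ^ n
  ^-mono-≤ zero    0≤x x≤y = ≤-refl
  ^-mono-≤ (suc n) 0≤x x≤y = *-mono-≤ 0≤x (^-nonneg n 0≤x) x≤y (^-mono-≤ n 0≤x x≤y)

  1^n≈1 : ∀ n → 1# ^ n ≈ 1#
  1^n≈1 zero    = refl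
  1^n≈1 (suc n) = trans (*-identityˡ _) (1^n≈1 n)

  ^-≤1 : ∀ {x} n → 0# ≤ x → x ≤ 1# → x ^ n ≤ 1#
  ^-≤1 n 0≤x x≤1 = ≤-trans (^-mono-≤ n 0≤x x≤1) (≤-reflexive (1^n≈1 n))

  -- Serves twice in `chernoff⇒power`: to pass from one factor per sample to an `m`-th power, and to
  -- see that an error of order `1 / k²` in each of `k` factors costs only order `1 / k` in total.
  bernoulli : ∀ {x} n → 0# ≤ x → x ≤ 1# → 1# - fromℕ n * x ≤ (1# - x) ^ n
  bernoulli {x} zero    0≤x x≤1 = ≤-reflexive (solve 1 (λ x → con (+ 1) :- con (+ 0) :* x := con (+ 1)) refl x)
  bernoulli {x} (suc n) 0≤x x≤1 = begin
    1# - (1# + fromℕ n) * x         ≤⟨ ≤-byDifference (*-nonneg (fromℕ-nonneg n) (*-nonneg 0≤x 0≤x))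
      (solve 2 (λ n x → con (+ 1) :- (con (+ 1) :+ n) :* x :+ n :* (x :* x) := (con (+ 1) :- x) :* (con (+ 1) :- n :* x)) refl (fromℕ n) x) ⟩
    (1# - x) * (1# - fromℕ n * x)   ≤⟨ *-monoˡ-≤ (x≤y⇒0≤y-x x≤1) (bernoulli n 0≤x x≤1) ⟩
    (1# - x) * (1# - x) ^ n         ∎


  open import Algebra.Construct.NaturalChoice.Max totalOrder public using (x≤x⊔y; x≤y⊔x; ⊔-lub)
  open import Algebra.Construct.NaturalChoice.Min totalOrder public using (⊓-glb)

  x≤abs : ∀ x → x ≤ abs x
  x≤abs x = x≤x⊔y x (- x)

  -x≤abs : ∀ x → - x ≤ abs x
  -x≤abs x = x≤y⊔x x (- x)

  abs-nonneg : ∀ x → 0# ≤ abs x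
  abs-nonneg x with total 0# x
  ... | inj₁ 0≤x = ≤-trans 0≤x (x≤abs x)
  ... | inj₂ x≤0 = ≤-trans (≤-trans (x≤y⇒0≤y-x x≤0) (≤-reflexive (+-identityˡ (- x)))) (-x≤abs x)

  abs-lub : ∀ {x y} → x ≤ y → - x ≤ y → abs x ≤ y
  abs-lub = ⊔-lub

-- Finite sums and products, and the range of a silhouette quotient.

module SumProperties {c ℓ₁ ℓ₂} (ℝ : Reals c ℓ₁ ℓ₂) where

  open Reals ℝ hiding (zero)
  open RealProperties ℝ
  open OrderProperties ℝ
  open import Algebra.Properties.Semiring.Sum semiring public
    using (*-distribˡ-sum; *-distribʳ-sum; ∑-distrib-+; sum-cong-≋)

  sum-mono-≤ : ∀ {n} {f g : Vector Carrier n} → (∀ i → f i ≤ g i) → sum f ≤ sum g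
  sum-mono-≤ {zero}  f≤g = ≤-refl
  sum-mono-≤ {suc n} f≤g = +-mono-≤ (f≤g zero) (sum-mono-≤ λ i → f≤g (suc i))

  sum-nonneg : ∀ {n} {f : Vector Carrier n} → (∀ i → 0# ≤ f i) → 0# ≤ sum f
  sum-nonneg {zero}  0≤f = ≤-refl
  sum-nonneg {suc n} 0≤f = +-nonneg (0≤f zero) (sum-nonneg λ i → 0≤f (suc i))

  sum-const : ∀ n x → sum {n} (λ _ → x) ≈ fromℕ n * x
  sum-const zero    x = sym (zeroˡ x)
  sum-const (suc n) x = trans (+-congˡ (sum-const n x)) (solve 2 (λ n x → x :+ n :* x := (con (+ 1) :+ n) :* x) refl (fromℕ n) x)

  sum-neg : ∀ {n} (f : Vector Carrier n) → sum (λ i → - f i) ≈ - sum f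
  sum-neg {zero}  f = solve 0 (con (+ 0) := :- con (+ 0)) refl
  sum-neg {suc n} f = trans (+-congˡ (sum-neg λ i → f (suc i)))
    (solve 2 (λ x y → :- x :+ :- y := :- (x :+ y)) refl (f zero) _)

  product-nonneg : ∀ {n} {f : Vector Carrier n} → (∀ i → 0# ≤ f i) → 0# ≤ product f
  product-nonneg {zero}  0≤f = 0≤1
  product-nonneg {suc n} 0≤f = *-nonneg (0≤f zero) (product-nonneg λ i → 0≤f (suc i))

  product-distrib-* : ∀ {n} (f g : Vector Carrier n) → product (λ i → f i * g i) ≈ product f * product g
  product-distrib-* {zero}  f g = sym (*-identityˡ 1#)
  product-distrib-* {suc n} f g = trans (*-congˡ (product-distrib-* (λ i → f (suc i)) (λ i → g (suc i))))
    (solve 4 (λ a b p q → a :* b :* (p :* q) := a :* p :* (b :* q)) refl (f zero) (g zero) _ _)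

  product-^ : ∀ {n} (f : Vector Carrier n) k → product (λ i → f i ^ k) ≈ product f ^ k
  product-^ {zero}  f k = sym (1^n≈1 k)
  product-^ {suc n} f k = trans (*-congˡ (product-^ (λ i → f (suc i)) k)) (sym (^-distrib-* (f zero) _ k))

  minimum-nonneg : ∀ {n} {f : Vector Carrier (suc n)} → (∀ i → 0# ≤ f i) → 0# ≤ minimum f
  minimum-nonneg {n} {f} 0≤f = go (λ i → f (suc i)) (0≤f zero) (λ i → 0≤f (suc i))
    where
    go : ∀ {n x} (g : Vector Carrier n) → 0# ≤ x → (∀ i → 0# ≤ g i) →
         0# ≤ foldr _⊓_ x g
    go {zero}  g 0≤x 0≤g = 0≤x
    go {suc n} g 0≤x 0≤g = ⊓-glb (0≤g zero) (go (λ i → g (suc i)) 0≤x (λ i → 0≤g (suc i)))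

  -- A quotient by 0 is 0 by convention, so a nonnegative `y` suffices and `abs-≤1` need not
  -- separate the case `a ⊔ b ≈ 0#`.
  x≤y⇒x/y≤1 : ∀ {x y} → 0# ≤ y → x ≤ y → x / y ≤ 1#
  x≤y⇒x/y≤1 {x} {y} 0≤y x≤y = ≤-trans (*-monoʳ-≤ (⁻¹-nonneg 0≤y) x≤y) y/y≤1
    where
    y/y≤1 : y / y ≤ 1#
    y/y≤1 with y ≤? 0#
    ... | yes y≤0 = ≤-trans (*-monoʳ-≤ (⁻¹-nonneg 0≤y) y≤0) (≤-trans (≤-reflexive (zeroˡ _)) 0≤1)
    ... | no  y≰0 = ≤-reflexive (⁻¹-inverse (≰⇒> y≰0))

  -- Subtracting a nonnegative number from `b`, or from `a`, leaves at most `a ⊔ b`; this gives both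
  -- signs.
  abs-≤1 : ∀ {a b} → 0# ≤ a → 0# ≤ b → abs ((b - a) / (a ⊔ b)) ≤ 1#
  abs-≤1 {a} {b} 0≤a 0≤b = abs-lub
    (x≤y⇒x/y≤1 0≤a⊔b (≤-trans (≤-byDifference 0≤a (solve 2 (λ a b → b :- a :+ a := b) refl a b)) (x≤y⊔x a b)))
    (≤-trans (≤-reflexive (solve 3 (λ a b r → :- ((b :- a) :* r) := (a :- b) :* r) refl a b _))
      (x≤y⇒x/y≤1 0≤a⊔b (≤-trans (≤-byDifference 0≤b (solve 2 (λ a b → a :- b :+ b := a) refl a b)) (x≤x⊔y a b))))
    where
    0≤a⊔b : 0# ≤ a ⊔ b
    0≤a⊔b = ≤-trans 0≤a (x≤x⊔y a b)

-- Silhouette values lie between -1 and 1.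

module SilhouetteRange {c ℓ₁ ℓ₂ u ℓ} (ℝ : Reals c ℓ₁ ℓ₂) {U : MetricSpace ℝ u ℓ} {n k}
                       (V : Dataset ℝ U n) (𝒞 : Clustering n k) where

  open Reals ℝ
  open OrderProperties ℝ
  open SumProperties ℝ
  open RealProperties ℝ
  open Silhouette ℝ V 𝒞
  open MetricSpace U
  open Clustering 𝒞
  open Dataset V

  distanceSum-nonneg : ∀ e C → 0# ≤ distanceSum e C
  distanceSum-nonneg e C = sum-nonneg λ e′ → go (does (e′ ∈? C)) e′
    where
    go : ∀ t e′ → 0# ≤ (if t then d (element e) (element e′) else 0#)
    go true  e′ = IsGeneralMetric.nonNegative isMetric
    go false e′ = ≤-refl

  a-nonneg : ∀ e → 0# ≤ a e
  a-nonneg e = /-nonneg (distanceSum-nonneg e C) (fromℕ-nonneg (∣ C ∣ ℕ.∸ 1))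
    where C = cluster (clusterOf e)

  minimumOthers-nonneg : ∀ {k} (2≤k : 2 ℕ.≤ k) {f : Vector Carrier k} j →
                         (∀ i → 0# ≤ f i) → 0# ≤ minimumOthers 2≤k f j
  minimumOthers-nonneg (s≤s (s≤s z≤n)) j 0≤f = minimum-nonneg λ i → 0≤f (Fin.punchIn j i)

  b-nonneg : ∀ e → 0# ≤ b e
  b-nonneg e = minimumOthers-nonneg 2≤k (clusterOf e) λ j →
    /-nonneg (distanceSum-nonneg e (cluster j)) (fromℕ-nonneg ∣ cluster j ∣)

  abs-s≤1 : ∀ e → abs (s e) ≤ 1#
  abs-s≤1 e with does (2 ℕ.≤? ∣ cluster (clusterOf e) ∣)
  ... | true  = abs-≤1 (a-nonneg e) (b-nonneg e)
  ... | false = abs-lub 0≤1 (≤-trans (≤-reflexive (solve 0 (:- con (+ 0) := con (+ 0)) refl)) 0≤1)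

-- The moment bound for one draw, and Markov's inequality for independent draws.

module Concentration {c ℓ₁ ℓ₂} (ℝ : Reals c ℓ₁ ℓ₂) where

  open Reals ℝ hiding (zero)
  open RealProperties ℝ
  open OrderProperties ℝ
  open SumProperties ℝ
  open import Relation.Binary.Reasoning.PartialOrder poset

  sum-linear : ∀ {n} (f g : Vector Carrier n) x → sum (λ i → f i + x * g i) ≈ sum f + x * sum g
  sum-linear f g x = trans (∑-distrib-+ f (λ i → x * g i)) (+-congˡ (sym (*-distribˡ-sum x g)))

  -- Bernoulli's inequality for `z / x`, multiplied by `x ^ suc n` to stay free of division.
  x^n*[x+nz]≤x*[x+z]^n : ∀ {x z} n → 0# ≤ x → 0# ≤ z → x ^ n * (x + fromℕ n * z) ≤ x * (x + z) ^ n
  x^n*[x+nz]≤x*[x+z]^n {x} {z} zero 0≤x 0≤z = ≤-reflexive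
    (solve 2 (λ x z → con (+ 1) :* (x :+ con (+ 0) :* z) := x :* con (+ 1)) refl x z)
  x^n*[x+nz]≤x*[x+z]^n {x} {z} (suc n) 0≤x 0≤z = begin
    x * x ^ n * (x + (1# + fromℕ n) * z)
      ≤⟨ ≤-byDifference (*-nonneg (*-nonneg (^-nonneg n 0≤x) (fromℕ-nonneg n)) (square-nonneg z))
           (solve 4 (λ x z n p → x :* p :* (x :+ (con (+ 1) :+ n) :* z) :+ p :* n :* (z :* z) := (x :+ z) :* (p :* (x :+ n :* z)))
             refl x z (fromℕ n) (x ^ n)) ⟩
    (x + z) * (x ^ n * (x + fromℕ n * z))
      ≤⟨ *-monoˡ-≤ (+-nonneg 0≤x 0≤z) (x^n*[x+nz]≤x*[x+z]^n n 0≤x 0≤z) ⟩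
    (x + z) * (x * (x + z) ^ n)
      ≈⟨ solve 3 (λ x y p → y :* (x :* p) := x :* (y :* p)) refl x (x + z) ((x + z) ^ n) ⟩
    x * ((x + z) * (x + z) ^ n) ∎

  module _ {n} (p X : Vector Carrier n) (μ h : Carrier)
           (0≤p : ∀ i → 0# ≤ p i) (∑p≈1 : sum p ≈ 1#)
           (X²≤1 : ∀ i → X i * X i ≤ 1#) (mean : sum (λ i → p i * X i) ≈ μ)
           (0≤h : 0# ≤ h) (0≤1+hY : ∀ i → 0# ≤ 1# + h * (X i - μ)) where

    private
      Y : Vector Carrier n
      Y i = X i - μ

      w : ℕ → Vector Carrier n
      w j i = p i * (1# + h * Y i) ^ j

      -- The moments of `Y` of orders 0, 1 and 2 under `w j`. They are left unnormalised so that the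
      -- recursions in `j` are linear; `A j` is the quantity that the moment bound concerns.
      A B D : ℕ → Carrier
      A j = sum (w j)
      B j = sum λ i → w j i * Y i
      D j = sum λ i → w j i * (Y i * Y i)

      0≤w : ∀ j i → 0# ≤ w j i
      0≤w j i = *-nonneg (0≤p i) (^-nonneg j (0≤1+hY i))

      0≤D : ∀ j → 0# ≤ D j
      0≤D j = sum-nonneg λ i → *-nonneg (0≤w j i) (square-nonneg (Y i))

      A-suc : ∀ j → A (suc j) ≈ A j + h * B j
      A-suc j = trans
        (sum-cong-≋ λ i → solve 4 (λ p q h y → p :* ((con (+ 1) :+ h :* y) :* q) := p :* q :+ h :* (p :* q :* y))
          refl (p i) ((1# + h * Y i) ^ j) h (Y i))
        (sum-linear (w j) _ h)

      B-suc : ∀ j → B (suc j) ≈ B j + h * D j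
      B-suc j = trans
        (sum-cong-≋ λ i → solve 4 (λ p q h y → p :* ((con (+ 1) :+ h :* y) :* q) :* y := p :* q :* y :+ h :* (p :* q :* (y :* y)))
          refl (p i) ((1# + h * Y i) ^ j) h (Y i))
        (sum-linear (λ i → w j i * Y i) _ h)

      -- This is `X² ≤ 1` averaged over `w j`, with `X` expanded as `Y + μ`.
      second-moment : ∀ j → D j + (μ + μ) * B j + μ * μ * A j ≤ A j
      second-moment j = begin
        D j + (μ + μ) * B j + μ * μ * A j
          ≈⟨ +-congʳ (sum-linear (λ i → w j i * (Y i * Y i)) (λ i → w j i * Y i) (μ + μ)) ⟨
        sum (λ i → w j i * (Y i * Y i) + (μ + μ) * (w j i * Y i)) + μ * μ * A j
          ≈⟨ sum-linear _ (w j) (μ * μ) ⟨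
        sum (λ i → w j i * (Y i * Y i) + (μ + μ) * (w j i * Y i) + μ * μ * w j i)
          ≤⟨ sum-mono-≤ (λ i → ≤-byDifference (*-nonneg (0≤w j i) (x≤y⇒0≤y-x (X²≤1 i)))
               (solve 3 (λ w x μ → w :* ((x :- μ) :* (x :- μ)) :+ (μ :+ μ) :* (w :* (x :- μ)) :+ μ :* μ :* w :+ w :* (con (+ 1) :- x :* x) := w)
                 refl (w j i) (X i) μ)) ⟩
        A j ∎

      -- The variance of X under the weights w j is at most 1.
      variance : ∀ j → 0# ≤ A j → A j * D j ≤ A j * A j + B j * B j
      -- Variance is second moment minus squared mean: the first summand is the slack of
      -- `second-moment`, and `B j + μ * A j` is the unnormalised mean of `X`.
      variance j 0≤A = ≤-byDifference
        (+-nonneg (*-nonneg 0≤A (x≤y⇒0≤y-x (second-moment j))) (square-nonneg (B j + μ * A j)))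
        (solve 4 (λ a b d μ → a :* d :+ (a :* (a :- (d :+ (μ :+ μ) :* b :+ μ :* μ :* a)) :+ (b :+ μ :* a) :* (b :+ μ :* a)) := a :* a :+ b :* b)
          refl (A j) (B j) (D j) μ)

      -- The mean B j / A j of Y under the weights w j grows by at most h per step.
      Drift : ℕ → Set ℓ₂
      Drift j = 1# ≤ A j × 0# ≤ B j × B j ≤ fromℕ j * h * A j

      -- The three claims need each other: `0# ≤ B j` keeps `A` from falling below 1, and `1# ≤ A j`
      -- permits cancelling `A j` in the bound on the mean.
      drift : ∀ j → Drift j
      drift zero = ≤-reflexive (sym A₀≈1) , ≤-reflexive (sym B₀≈0) ,
        ≤-reflexive (trans B₀≈0 (solve 2 (λ h a → con (+ 0) := con (+ 0) :* h :* a) refl h (A 0)))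
        where
        A₀≈1 : A 0 ≈ 1#
        A₀≈1 = trans (sum-cong-≋ λ i → *-identityʳ (p i)) ∑p≈1
        B₀≈0 : B 0 ≈ 0#
        B₀≈0 = begin-equality
          B 0                            ≈⟨ sum-cong-≋ (λ i → solve 3 (λ p x μ → p :* con (+ 1) :* (x :- μ) := p :* x :+ (:- μ) :* p) refl (p i) (X i) μ) ⟩
          sum (λ i → p i * X i + - μ * p i) ≈⟨ sum-linear _ p (- μ) ⟩
          sum (λ i → p i * X i) + - μ * sum p ≈⟨ +-cong mean (*-congˡ ∑p≈1) ⟩
          μ + - μ * 1#                   ≈⟨ solve 1 (λ μ → μ :+ (:- μ) :* con (+ 1) := con (+ 0)) refl μ ⟩
          0#                             ∎
      drift (suc j) with 1≤A , 0≤B , B≤jhA ← drift j =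
          ≤-trans 1≤A (≤-trans (≤-byDifference (*-nonneg 0≤h 0≤B) refl) (≤-reflexive (sym (A-suc j))))
        , ≤-trans (+-nonneg 0≤B (*-nonneg 0≤h (0≤D j))) (≤-reflexive (sym (B-suc j)))
        , *-cancelˡ-≤ 0<A (begin
            A j * B (suc j)       ≈⟨ *-congˡ (B-suc j) ⟩
            A j * (B j + h * D j)
              -- By `variance` the left side is at most `A B + h (A² + B²)`. The induction
              -- hypothesis `B ≤ j h A` is then used once in `A B` and once in `h B²`; the surplus
              -- on the right is `h² A B`.
              ≤⟨ ≤-byDifference
                   (+-nonneg (*-nonneg gap 0≤A)
                   (+-nonneg (*-nonneg 0≤h (x≤y⇒0≤y-x (variance j 0≤A)))
                   (+-nonneg (*-nonneg (*-nonneg 0≤h 0≤B) gap)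
                             (*-nonneg (*-nonneg 0≤h 0≤h) (*-nonneg 0≤A 0≤B)))))
                   (solve 5 (λ a b d h j →
                       a :* (b :+ h :* d)
                       :+ ((j :* h :* a :- b) :* a :+ (h :* (a :* a :+ b :* b :- a :* d)
                       :+ (h :* b :* (j :* h :* a :- b) :+ h :* h :* (a :* b))))
                       := a :* ((con (+ 1) :+ j) :* h :* (a :+ h :* b)))
                     refl (A j) (B j) (D j) h (fromℕ j)) ⟩
            A j * (fromℕ (suc j) * h * (A j + h * B j)) ≈⟨ *-congˡ (*-congˡ (A-suc j)) ⟨
            A j * (fromℕ (suc j) * h * A (suc j)) ∎)
        where
        gap = x≤y⇒0≤y-x B≤jhA
        0≤A = ≤-trans 0≤1 1≤A
        0<A = ≰⇒> λ A≤0 → 1≰0 (≤-trans 1≤A A≤0)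

    -- This is E exp (t Y) ≤ exp (t² / 2) with exp t replaced by (1 + t / j) ^ j.
    hoeffding-lemma : ∀ {z} → 0# ≤ z → h * h ≈ z + z → ∀ j →
                      sum (λ i → p i * (1# + h * (X i - μ)) ^ j) ≤ (1# + fromℕ j * z) ^ j
    hoeffding-lemma 0≤z h²≈2z zero = ≤-reflexive (trans (sum-cong-≋ λ i → *-identityʳ (p i)) ∑p≈1)
    hoeffding-lemma {z} 0≤z h²≈2z (suc j) with 1≤A , 0≤B , B≤jhA ← drift j = begin
      A (suc j)                           ≈⟨ A-suc j ⟩
      A j + h * B j                       ≤⟨ +-mono-≤ ≤-refl (*-monoˡ-≤ 0≤h B≤jhA) ⟩
      A j + h * (fromℕ j * h * A j)       ≈⟨ solve 3 (λ a h j → a :+ h :* (j :* h :* a) := a :* (con (+ 1) :+ j :* (h :* h))) refl (A j) h (fromℕ j) ⟩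
      A j * (1# + fromℕ j * (h * h))      ≈⟨ *-congˡ (+-congˡ (*-congˡ h²≈2z)) ⟩
      A j * (1# + fromℕ j * (z + z))      ≤⟨ *-monoʳ-≤ (+-nonneg 0≤1 (*-nonneg (fromℕ-nonneg j) (+-nonneg 0≤z 0≤z))) (hoeffding-lemma 0≤z h²≈2z j) ⟩
      x ^ j * (1# + fromℕ j * (z + z))    ≈⟨ *-congˡ (solve 2 (λ j z → con (+ 1) :+ j :* (z :+ z) := con (+ 1) :+ j :* z :+ j :* z) refl (fromℕ j) z) ⟩
      -- The growth factor is `1 + 2 j z`. Half of the increment supplies the missing factor `x`;
      -- the other half is at most what Bernoulli's inequality gains when the base rises from `x` to
      -- `x + z`.
      x ^ j * (x + fromℕ j * z)           ≤⟨ x^n*[x+nz]≤x*[x+z]^n j 0≤x 0≤z ⟩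
      x * (x + z) ^ j                     ≤⟨ *-monoʳ-≤ (^-nonneg j (+-nonneg 0≤x 0≤z)) (≤-byDifference 0≤z refl) ⟩
      (x + z) ^ suc j                     ≈⟨ ^-congˡ (suc j) (solve 2 (λ j z → con (+ 1) :+ j :* z :+ z := con (+ 1) :+ (con (+ 1) :+ j) :* z) refl (fromℕ j) z) ⟩
      (1# + fromℕ (suc j) * z) ^ suc j    ∎
      where
      x = 1# + fromℕ j * z
      0≤x = +-nonneg 0≤1 (*-nonneg (fromℕ-nonneg j) 0≤z)

  sum-splitAt : ∀ m {n} (f : Vector Carrier m) (g : Vector Carrier n) →
                sum (λ t → [ f , g ]′ (splitAt m t)) ≈ sum f + sum g
  sum-splitAt zero    f g = sym (+-identityˡ _)
  sum-splitAt (suc m) f g = trans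
    (+-congˡ (trans (sum-cong-≋ λ t → go t) (sum-splitAt m (λ i → f (suc i)) g)))
    (sym (+-assoc _ _ _))
    where
    go : ∀ t → [ f , g ]′ (splitAt (suc m) (suc t)) ≈ [ (λ i → f (suc i)) , g ]′ (splitAt m t)
    go t with splitAt m t
    ... | inj₁ _ = refl
    ... | inj₂ _ = refl

  sum-remQuot : ∀ m {n} (f : Fin m × Fin n → Carrier) →
                sum (λ t → f (remQuot {m} n t)) ≈ sum λ i → sum λ j → f (i , j)
  sum-remQuot zero        f = refl
  sum-remQuot (suc m) {n} f = begin-equality
    sum (λ t → f (remQuot {suc m} n t)) ≈⟨ sum-cong-≋ go ⟩
    sum (λ t → [ (λ j → f (zero , j)) , (λ t → f′ (remQuot {m} n t)) ]′ (splitAt n t)) ≈⟨ sum-splitAt n _ _ ⟩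
    sum (λ j → f (zero , j)) + sum (λ t → f′ (remQuot {m} n t)) ≈⟨ +-congˡ (sum-remQuot m f′) ⟩
    sum (λ i → sum λ j → f (i , j)) ∎
    where
    f′ : Fin m × Fin n → Carrier
    f′ (i , j) = f (suc i , j)
    go : ∀ t → f (remQuot {suc m} n t) ≈ [ (λ j → f (zero , j)) , (λ t → f′ (remQuot {m} n t)) ]′ (splitAt n t)
    go t with splitAt n t
    ... | inj₁ _ = refl
    ... | inj₂ _ = refl

  -- Independence of the draws. `finToFun` decodes an index below `n ^ suc m` by `remQuot` into one
  -- draw and an index below `n ^ m`, so the sum factors by distributivity.
  sum-product : ∀ {n} (f : Vector Carrier n) m →
                sum {n ℕ.^ m} (λ t → product (λ l → f (finToFun {n} {m} t l))) ≈ sum f ^ m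
  sum-product f zero = +-identityʳ 1#
  sum-product {n} f (suc m) = begin-equality
    sum {n ℕ.^ suc m} (λ t → product (λ l → f (finToFun {n} {suc m} t l)))
      ≈⟨ sum-remQuot n {n ℕ.^ m} (λ (i , t) → f i * product (λ l → f (finToFun {n} {m} t l))) ⟩
    sum (λ i → sum λ t → f i * product (λ l → f (finToFun {n} {m} t l)))
      ≈⟨ sum-cong-≋ (λ i → trans (sym (*-distribˡ-sum {n ℕ.^ m} (f i) _)) (*-congˡ (sum-product f m))) ⟩
    sum (λ i → f i * sum f ^ m)  ≈⟨ *-distribʳ-sum (sum f ^ m) f ⟨
    sum f * sum f ^ m            ∎

  -- The bad event is the complement of `P`; its probability is written `1# - Pr`, which
  -- `sum-product` justifies by giving the masses total 1. Pointwise, `x` times the indicator of the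
  -- bad event is at most `W`.
  markov : ∀ {n} (p : Vector Carrier n) m {q} {P : Pred (Fin m → Fin n) q} (P? : Decidable P) →
           (∀ i → 0# ≤ p i) → sum p ≈ 1# →
           ∀ {x} (W : (Fin m → Fin n) → Carrier) → (∀ ω → 0# ≤ W ω) → (∀ ω → ¬ P ω → x ≤ W ω) →
           x * (1# - Pr ℝ p m P?) ≤ sum {n ℕ.^ m} λ t →
             let ω = finToFun {n} {m} t in product (λ l → p (ω l)) * W ω
  markov {n} p m {P = P} P? 0≤p ∑p≈1 {x} W 0≤W x≤W = begin
    x * (1# - Pr ℝ p m P?)
      ≈⟨ *-congˡ (+-congʳ (trans (sum-product p m) (trans (^-congˡ m ∑p≈1) (1^n≈1 m)))) ⟨
    x * (sum mass - Pr ℝ p m P?)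
      ≈⟨ solve 3 (λ x a b → x :* (a :- b) := x :* a :+ (:- x) :* b) refl x (sum mass) _ ⟩
    x * sum mass + - x * Pr ℝ p m P?
      ≈⟨ +-congʳ (*-distribˡ-sum x mass) ⟩
    sum (λ t → x * mass t) + - x * Pr ℝ p m P?
      ≈⟨ sum-linear {n ℕ.^ m} _ _ (- x) ⟨
    sum (λ t → x * mass t + - x * (if does (P? (ω t)) then mass t else 0#))
      ≤⟨ sum-mono-≤ (λ t → pointwise t) ⟩
    sum (λ t → mass t * W (ω t)) ∎
    where
    ω : Fin (n ℕ.^ m) → Fin m → Fin n
    ω = finToFun {n} {m}
    mass : Vector Carrier (n ℕ.^ m)
    mass t = product λ l → p (ω t l)
    0≤mass : ∀ t → 0# ≤ mass t
    0≤mass t = product-nonneg λ l → 0≤p (ω t l)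
    pointwise : ∀ t → x * mass t + - x * (if does (P? (ω t)) then mass t else 0#) ≤ mass t * W (ω t)
    pointwise t with P? (ω t)
    ... | yes _  = ≤-trans (≤-reflexive (solve 2 (λ x a → x :* a :+ (:- x) :* a := con (+ 0)) refl x (mass t)))
                     (*-nonneg (0≤mass t) (0≤W (ω t)))
    ... | no ¬Pω = ≤-trans (≤-reflexive (solve 2 (λ x a → x :* a :+ (:- x) :* con (+ 0) := a :* x) refl x (mass t)))
                     (*-monoˡ-≤ (0≤mass t) (x≤W (ω t) ¬Pω))

-- Estimates for falling factorials, powers and factorials in ℕ.

nCk*k!≡nP′k : ∀ {n k} → k ℕ.≤ n → (n C k) ℕ.* k ! ≡ n P′ k
nCk*k!≡nP′k {n} {k} k≤n = begin
  (n C k) ℕ.* k !   ≡⟨ ≡.cong (ℕ._* k !) (≡.trans (nCk≡n!/k![n-k]! k≤n) (≡.sym (nC′k≡n!/k![n-k]! k≤n))) ⟩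
  (n C′ k) ℕ.* k !  ≡⟨ m/n*n≡m {{ℕ._!≢0 k}} (k!∣nP′k k≤n) ⟩
  n P′ k            ∎
  where open ≡.≡-Reasoning

nP′k≤n^k : ∀ n k → n P′ k ℕ.≤ n ℕ.^ k
nP′k≤n^k n zero    = ℕ.≤-refl
nP′k≤n^k n (suc k) = ℕ.*-mono-≤ (ℕ.m∸n≤m n k) (nP′k≤n^k n k)

-- This is `(n P′ k) / n ^ k ≥ 1 − k² / n` cleared of denominators. The factor `n ∸ k` instead of
-- `n` loses a further `k / n`, and `k² + k ≤ (k + 1)²`; writing `n ≤ k + (n ∸ k)` also covers
-- `k > n`.
n*n^k≤n*nP′k+k*k*n^k : ∀ n k → n ℕ.* n ℕ.^ k ℕ.≤ n ℕ.* (n P′ k) ℕ.+ k ℕ.* k ℕ.* n ℕ.^ k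
n*n^k≤n*nP′k+k*k*n^k n zero    = ℕ.m≤m+n (n ℕ.* 1) 0
n*n^k≤n*nP′k+k*k*n^k n (suc k) = begin
  n ℕ.* (n ℕ.* q)                         ≤⟨ ℕ.*-monoʳ-≤ n (n*n^k≤n*nP′k+k*k*n^k n k) ⟩
  n ℕ.* (n ℕ.* p ℕ.+ k ℕ.* k ℕ.* q)       ≤⟨ ℕ.*-monoʳ-≤ n (ℕ.+-monoˡ-≤ _ (ℕ.*-monoˡ-≤ p (ℕ.m≤n+m∸n n k))) ⟩
  n ℕ.* ((k ℕ.+ (n ℕ.∸ k)) ℕ.* p ℕ.+ k ℕ.* k ℕ.* q)  ≡⟨ expand n k (n ℕ.∸ k) p q ⟩
  n ℕ.* ((n ℕ.∸ k) ℕ.* p) ℕ.+ (k ℕ.* (n ℕ.* p) ℕ.+ k ℕ.* k ℕ.* (n ℕ.* q))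
    ≤⟨ ℕ.+-monoʳ-≤ (n ℕ.* ((n ℕ.∸ k) ℕ.* p)) (begin
      k ℕ.* (n ℕ.* p) ℕ.+ k ℕ.* k ℕ.* (n ℕ.* q)  ≤⟨ ℕ.+-monoˡ-≤ _ (ℕ.*-monoʳ-≤ k (ℕ.*-monoʳ-≤ n (nP′k≤n^k n k))) ⟩
      k ℕ.* (n ℕ.* q) ℕ.+ k ℕ.* k ℕ.* (n ℕ.* q)  ≡⟨ ℕ.*-distribʳ-+ (n ℕ.* q) k (k ℕ.* k) ⟨
      (suc k ℕ.* k) ℕ.* (n ℕ.* q)                ≤⟨ ℕ.*-monoˡ-≤ (n ℕ.* q) (ℕ.*-monoʳ-≤ (suc k) (ℕ.n≤1+n k)) ⟩
      suc k ℕ.* suc k ℕ.* (n ℕ.* q)              ∎) ⟩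
  n ℕ.* ((n ℕ.∸ k) ℕ.* p) ℕ.+ suc k ℕ.* suc k ℕ.* (n ℕ.* q) ∎
  where
  open ℕ.≤-Reasoning
  p = n P′ k
  q = n ℕ.^ k
  expand : ∀ n k d p q → n ℕ.* ((k ℕ.+ d) ℕ.* p ℕ.+ k ℕ.* k ℕ.* q) ≡ n ℕ.* (d ℕ.* p) ℕ.+ (k ℕ.* (n ℕ.* p) ℕ.+ k ℕ.* k ℕ.* (n ℕ.* q))
  expand = solve-∀

n<2^n : ∀ n → n ℕ.< 2 ℕ.^ n
n<2^n zero    = s≤s z≤n
n<2^n (suc n) = begin-strict
  suc n                   <⟨ s≤s (n<2^n n) ⟩
  suc (2 ℕ.^ n)           ≤⟨ ℕ.+-monoˡ-≤ _ (ℕ.m^n>0 2 n) ⟩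
  2 ℕ.^ n ℕ.+ 2 ℕ.^ n     ≡⟨ ≡.cong (2 ℕ.^ n ℕ.+_) (ℕ.+-identityʳ (2 ℕ.^ n)) ⟨
  2 ℕ.^ suc n             ∎
  where open ℕ.≤-Reasoning

n*n≤4^n : ∀ n → n ℕ.* n ℕ.≤ 4 ℕ.^ n
n*n≤4^n n = begin
  n ℕ.* n               ≤⟨ ℕ.*-mono-≤ (ℕ.<⇒≤ (n<2^n n)) (ℕ.<⇒≤ (n<2^n n)) ⟩
  2 ℕ.^ n ℕ.* 2 ℕ.^ n   ≡⟨ ℕ.^-distribˡ-+-* 2 n n ⟨
  2 ℕ.^ (n ℕ.+ n)       ≡⟨ ≡.cong (λ k → 2 ℕ.^ (n ℕ.+ k)) (ℕ.+-identityʳ n) ⟨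
  2 ℕ.^ (2 ℕ.* n)       ≡⟨ ℕ.^-*-assoc 2 2 n ⟨
  4 ℕ.^ n               ∎
  where open ℕ.≤-Reasoning

-- Up to `n = m` the factor `m ^ m` alone suffices; beyond it each step multiplies the left side by
-- `m` and the right side by something at least as large. It bounds `m ^ n / n !` uniformly in `n`.
m^n≤m^m*n! : ∀ m n → m ℕ.^ n ℕ.≤ m ℕ.^ m ℕ.* n !
m^n≤m^m*n! zero n = ℕ.≤-trans (ℕ.^-monoˡ-≤ n (z≤n {1})) (ℕ.≤-trans (ℕ.≤-reflexive (ℕ.^-zeroˡ n)) (ℕ.≤-trans (ℕ.1≤n! n) (ℕ.≤-reflexive (≡.sym (ℕ.*-identityˡ (n !))))))
m^n≤m^m*n! m@(suc _) n with ℕ.≤-total n m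
... | inj₁ n≤m = begin
  m ℕ.^ n          ≤⟨ ℕ.^-monoʳ-≤ m n≤m ⟩
  m ℕ.^ m          ≡⟨ ℕ.*-identityʳ (m ℕ.^ m) ⟨
  m ℕ.^ m ℕ.* 1    ≤⟨ ℕ.*-monoʳ-≤ (m ℕ.^ m) (ℕ.1≤n! n) ⟩
  m ℕ.^ m ℕ.* n !  ∎
  where open ℕ.≤-Reasoning
m^n≤m^m*n! m@(suc _) (suc n) | inj₂ m≤1+n = begin
  m ℕ.* m ℕ.^ n                ≤⟨ ℕ.*-mono-≤ m≤1+n (m^n≤m^m*n! m n) ⟩
  suc n ℕ.* (m ℕ.^ m ℕ.* n !)  ≡⟨ swap (suc n) (m ℕ.^ m) (n !) ⟩
  m ℕ.^ m ℕ.* (suc n ℕ.* n !)  ∎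
  where
  open ℕ.≤-Reasoning
  swap : ∀ a b c → a ℕ.* (b ℕ.* c) ≡ b ℕ.* (a ℕ.* c)
  swap = solve-∀

-- The exponential series compared with powers of `1 + x / n`.

module ExponentialProperties {c ℓ₁ ℓ₂} (ℝ : Reals c ℓ₁ ℓ₂) where

  open Reals ℝ hiding (zero)
  open RealProperties ℝ
  open OrderProperties ℝ
  open SumProperties ℝ
  open import Algebra.Properties.CommutativeSemiring.Binomial commutativeSemiring
    using (binomialTerm; binomialExpansion) renaming (theorem to binomial-theorem)
  open import Algebra.Properties.Semiring.Mult semiring using (×-congʳ) renaming (×-assoc-* to ·-assoc-*)
  open import Relation.Binary.Reasoning.PartialOrder poset

  ½ : Carrier
  ½ = fromℕ 2 ⁻¹

  0≤½ : 0# ≤ ½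
  0≤½ = ⁻¹-nonneg (fromℕ-nonneg 2)

  ½+½≈1 : ½ + ½ ≈ 1#
  -- `fromℕ 2` unfolds to `1# + (1# + 0#)`; the solver term is spelled out in this shape so that
  -- both agree by computation. Later numerals follow suit.
  ½+½≈1 = trans (solve 1 (λ h → h :+ h := (con (+ 1) :+ (con (+ 1) :+ con (+ 0))) :* h) refl ½) (⁻¹-inverse (fromℕ-pos 1))

  ½*[2*x]≈x : ∀ x → ½ * (fromℕ 2 * x) ≈ x
  ½*[2*x]≈x x = trans (solve 2 (λ h x → h :* ((con (+ 1) :+ (con (+ 1) :+ con (+ 0))) :* x) := (h :+ h) :* x) refl ½ x)
    (trans (*-congʳ ½+½≈1) (*-identityˡ x))

  n·x≈fromℕn*x : ∀ n x → n · x ≈ fromℕ n * x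
  n·x≈fromℕn*x n x = trans (×-congʳ n (sym (*-identityˡ x))) (sym (·-assoc-* n 1# x))

  -- Both signs go through the induction together because a negative `x` exchanges them.
  ^-abs : ∀ x n → x ^ n ≤ abs x ^ n × - (x ^ n) ≤ abs x ^ n
  ^-abs x zero = ≤-refl , ≤-byDifference (+-nonneg 0≤1 0≤1) (solve 0 (:- con (+ 1) :+ (con (+ 1) :+ con (+ 1)) := con (+ 1)) refl)
  ^-abs x (suc n) with total 0# x | ^-abs x n
  ... | inj₁ 0≤x | p≤q , -p≤q =
      (begin
        x * x ^ n          ≤⟨ *-monoˡ-≤ 0≤x p≤q ⟩
        x * abs x ^ n      ≤⟨ *-monoʳ-≤ (^-nonneg n (abs-nonneg x)) (x≤abs x) ⟩
        abs x * abs x ^ n  ∎)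
    , (begin
        - (x * x ^ n)      ≈⟨ solve 2 (λ x p → :- (x :* p) := x :* :- p) refl x (x ^ n) ⟩
        x * - (x ^ n)      ≤⟨ *-monoˡ-≤ 0≤x -p≤q ⟩
        x * abs x ^ n      ≤⟨ *-monoʳ-≤ (^-nonneg n (abs-nonneg x)) (x≤abs x) ⟩
        abs x * abs x ^ n  ∎)
  ... | inj₂ x≤0 | p≤q , -p≤q =
      (begin
        x * x ^ n          ≈⟨ solve 2 (λ x p → x :* p := :- x :* :- p) refl x (x ^ n) ⟩
        - x * - (x ^ n)    ≤⟨ *-monoˡ-≤ 0≤-x -p≤q ⟩
        - x * abs x ^ n    ≤⟨ *-monoʳ-≤ (^-nonneg n (abs-nonneg x)) (-x≤abs x) ⟩
        abs x * abs x ^ n  ∎)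
    , (begin
        - (x * x ^ n)      ≈⟨ solve 2 (λ x p → :- (x :* p) := :- x :* p) refl x (x ^ n) ⟩
        - x * x ^ n        ≤⟨ *-monoˡ-≤ 0≤-x p≤q ⟩
        - x * abs x ^ n    ≤⟨ *-monoʳ-≤ (^-nonneg n (abs-nonneg x)) (-x≤abs x) ⟩
        abs x * abs x ^ n  ∎)
    where 0≤-x = ≤-trans (x≤y⇒0≤y-x x≤0) (≤-reflexive (+-identityˡ (- x)))

  0<n! : ∀ n → 0# < fromℕ (n !)
  0<n! n with n ! | ℕ.1≤n! n
  ... | suc k | _ = fromℕ-pos k

  n!*n!⁻¹≈1 : ∀ n → fromℕ (n !) * fromℕ (n !) ⁻¹ ≈ 1#
  n!*n!⁻¹≈1 n = ⁻¹-inverse (0<n! n)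

  sum-½^i≤2 : ∀ n → sum {n} (λ i → ½ ^ toℕ i) ≤ fromℕ 2
  sum-½^i≤2 zero    = fromℕ-nonneg 2
  sum-½^i≤2 (suc n) = begin
    1# + sum {n} (λ i → ½ * ½ ^ toℕ i)  ≈⟨ +-congˡ (*-distribˡ-sum {n} ½ _) ⟨
    1# + ½ * sum {n} (λ i → ½ ^ toℕ i)  ≤⟨ +-mono-≤ ≤-refl (*-monoˡ-≤ 0≤½ (sum-½^i≤2 n)) ⟩
    1# + ½ * fromℕ 2                    ≈⟨ +-congˡ (trans (*-comm _ _) (⁻¹-inverse (fromℕ-pos 1))) ⟩
    1# + 1#                             ≈⟨ +-congˡ (+-identityʳ 1#) ⟨
    fromℕ 2                             ∎

  -- Doubling the argument buys geometric decay: `x ^ i / i !` is `½ ^ i` times `(2 x) ^ i / i !`,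
  -- and the latter is at most `k ^ k`. A crude bound is enough, since it will be multiplied by
  -- `1 / n`.
  expPartialSum-bounded : ∀ {x} k → 0# ≤ x → fromℕ 2 * x ≤ fromℕ k →
                          ∀ n → expPartialSum x n ≤ fromℕ (k ℕ.^ k) * fromℕ 2
  expPartialSum-bounded {x} k 0≤x 2x≤k n = begin
    expPartialSum x n                             ≤⟨ sum-mono-≤ {n} (λ i → term (toℕ i)) ⟩
    sum {n} (λ i → fromℕ (k ℕ.^ k) * ½ ^ toℕ i)   ≈⟨ *-distribˡ-sum {n} (fromℕ (k ℕ.^ k)) _ ⟨
    fromℕ (k ℕ.^ k) * sum {n} (λ i → ½ ^ toℕ i)   ≤⟨ *-monoˡ-≤ (fromℕ-nonneg (k ℕ.^ k)) (sum-½^i≤2 n) ⟩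
    fromℕ (k ℕ.^ k) * fromℕ 2                     ∎
    where
    term : ∀ i → x ^ i / fromℕ (i !) ≤ fromℕ (k ℕ.^ k) * ½ ^ i
    term i = begin
      x ^ i * r                                ≈⟨ *-congʳ (^-congˡ i (½*[2*x]≈x x)) ⟨
      (½ * (fromℕ 2 * x)) ^ i * r              ≈⟨ *-congʳ (^-distrib-* ½ _ i) ⟩
      ½ ^ i * (fromℕ 2 * x) ^ i * r            ≤⟨ *-monoʳ-≤ 0≤r (*-monoˡ-≤ (^-nonneg i 0≤½) (^-mono-≤ i (*-nonneg (fromℕ-nonneg 2) 0≤x) 2x≤k)) ⟩
      ½ ^ i * fromℕ k ^ i * r                  ≈⟨ *-congʳ (*-congˡ (fromℕ-^ k i)) ⟨
      ½ ^ i * fromℕ (k ℕ.^ i) * r              ≤⟨ *-monoʳ-≤ 0≤r (*-monoˡ-≤ (^-nonneg i 0≤½) (fromℕ-mono-≤ (m^n≤m^m*n! k i))) ⟩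
      ½ ^ i * fromℕ (k ℕ.^ k ℕ.* i !) * r      ≈⟨ *-congʳ (*-congˡ (fromℕ-* (k ℕ.^ k) (i !))) ⟩
      ½ ^ i * (fromℕ (k ℕ.^ k) * fromℕ (i !)) * r ≈⟨ solve 4 (λ h b f r → h :* (b :* f) :* r := b :* h :* (f :* r)) refl (½ ^ i) (fromℕ (k ℕ.^ k)) (fromℕ (i !)) r ⟩
      fromℕ (k ℕ.^ k) * ½ ^ i * (fromℕ (i !) * r) ≈⟨ trans (*-congˡ (n!*n!⁻¹≈1 i)) (*-identityʳ _) ⟩
      fromℕ (k ℕ.^ k) * ½ ^ i                  ∎
      where
      r = fromℕ (i !) ⁻¹
      0≤r = ⁻¹-nonneg (fromℕ-nonneg (i !))

  -- The binomial coefficient satisfies 1 − i² / n ≤ (n C i) i! / n ^ i, and i² ≤ 4 ^ i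
  -- turns the error into a further partial sum.
  expPartialSum≤[1+x/n]^n : ∀ x n {ι} → 0# ≤ ι → fromℕ n * ι ≈ 1# →
    expPartialSum x (suc n) ≤ (1# + x * ι) ^ n + ι * expPartialSum (fromℕ 4 * abs x) (suc n)
  expPartialSum≤[1+x/n]^n x n {ι} 0≤ι nι≈1 = begin
    expPartialSum x (suc n)
      ≤⟨ sum-mono-≤ {suc n} (λ i → term (toℕ i) (ℕ.≤-pred (Fin.toℕ<n i))) ⟩
    sum {suc n} (λ i → (n C toℕ i) · ((x * ι) ^ toℕ i * 1# ^ (n ℕ.∸ toℕ i)) + ι * (y ^ toℕ i / fromℕ (toℕ i !)))
      ≈⟨ ∑-distrib-+ {suc n} (binomialTerm (x * ι) 1# n) (λ i → ι * (y ^ toℕ i / fromℕ (toℕ i !))) ⟩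
    binomialExpansion (x * ι) 1# n + sum {suc n} (λ i → ι * (y ^ toℕ i / fromℕ (toℕ i !)))
      ≈⟨ +-cong (trans (^-congˡ n (+-comm _ _)) (binomial-theorem n (x * ι) 1#)) (*-distribˡ-sum {suc n} ι (λ i → y ^ toℕ i / fromℕ (toℕ i !))) ⟨
    (1# + x * ι) ^ n + ι * expPartialSum y (suc n) ∎
    where
    y = fromℕ 4 * abs x
    term : ∀ i → i ℕ.≤ n → x ^ i / fromℕ (i !) ≤
           (n C i) · ((x * ι) ^ i * 1# ^ (n ℕ.∸ i)) + ι * (y ^ i / fromℕ (i !))
    term i i≤n = begin
      x ^ i * r
        ≈⟨ solve 4 (λ x r p s → x :* r := p :* r :* (x :* s) :+ x :* (r :* (con (+ 1) :- p :* s))) refl (x ^ i) r p (ι ^ i) ⟩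
      p * r * (x ^ i * ι ^ i) + x ^ i * (r * (1# - p * ι ^ i))
        ≈⟨ +-congʳ binomial-part ⟩
      (n C i) · ((x * ι) ^ i * 1# ^ (n ℕ.∸ i)) + x ^ i * (r * (1# - p * ι ^ i))
        ≤⟨ +-mono-≤ ≤-refl error-part ⟩
      (n C i) · ((x * ι) ^ i * 1# ^ (n ℕ.∸ i)) + ι * (y ^ i * r) ∎
      where
      r = fromℕ (i !) ⁻¹
      0≤r = ⁻¹-nonneg (fromℕ-nonneg (i !))
      p = fromℕ (n P′ i)
      0≤ι^i = ^-nonneg i 0≤ι
      n^iι^i≈1 : fromℕ n ^ i * ι ^ i ≈ 1#
      n^iι^i≈1 = trans (sym (^-distrib-* (fromℕ n) ι i)) (trans (^-congˡ i nι≈1) (1^n≈1 i))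

      binomial-part : p * r * (x ^ i * ι ^ i) ≈ (n C i) · ((x * ι) ^ i * 1# ^ (n ℕ.∸ i))
      binomial-part = begin-equality
        p * r * (x ^ i * ι ^ i)
          ≈⟨ *-congʳ (*-congʳ (trans (reflexive (≡.cong fromℕ (≡.sym (nCk*k!≡nP′k i≤n)))) (fromℕ-* (n C i) (i !)))) ⟩
        fromℕ (n C i) * fromℕ (i !) * r * (x ^ i * ι ^ i)
          ≈⟨ *-congʳ (trans (*-assoc _ _ _) (trans (*-congˡ (n!*n!⁻¹≈1 i)) (*-identityʳ _))) ⟩
        fromℕ (n C i) * (x ^ i * ι ^ i)
          ≈⟨ *-congˡ (trans (*-congˡ (1^n≈1 (n ℕ.∸ i))) (trans (*-identityʳ _) (^-distrib-* x ι i))) ⟨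
        fromℕ (n C i) * ((x * ι) ^ i * 1# ^ (n ℕ.∸ i))
          ≈⟨ n·x≈fromℕn*x (n C i) _ ⟨
        (n C i) · ((x * ι) ^ i * 1# ^ (n ℕ.∸ i)) ∎

      0≤1-pι^i : 0# ≤ 1# - p * ι ^ i
      0≤1-pι^i = x≤y⇒0≤y-x (begin
        p * ι ^ i                 ≤⟨ *-monoʳ-≤ 0≤ι^i (fromℕ-mono-≤ (nP′k≤n^k n i)) ⟩
        fromℕ (n ℕ.^ i) * ι ^ i   ≈⟨ trans (*-congʳ (fromℕ-^ n i)) n^iι^i≈1 ⟩
        1#                        ∎)

      1-pι^i≤4^iι : 1# - p * ι ^ i ≤ fromℕ 4 ^ i * ι
      1-pι^i≤4^iι = begin
        -- The 1 is expanded to `n ι n ^ i ι ^ i`, which brings the estimate on natural numbers into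
        -- play; afterwards `n ι` and `n ^ i ι ^ i` collapse again and `p * ι ^ i` cancels.
        1# - p * ι ^ i
          ≈⟨ +-congʳ (trans (sym (*-identityˡ 1#)) (*-cong (sym nι≈1) (sym n^iι^i≈1))) ⟩
        fromℕ n * ι * (fromℕ n ^ i * ι ^ i) - p * ι ^ i
          ≈⟨ +-congʳ (trans (solve 4 (λ n ι m s → n :* ι :* (m :* s) := n :* m :* (ι :* s)) refl _ _ _ _) (*-congʳ (trans (*-congˡ (sym (fromℕ-^ n i))) (sym (fromℕ-* n _))))) ⟩
        fromℕ (n ℕ.* n ℕ.^ i) * (ι * ι ^ i) - p * ι ^ i
          ≤⟨ +-monoˡ-≤ _ (*-monoʳ-≤ (*-nonneg 0≤ι 0≤ι^i) (fromℕ-mono-≤ (ℕ.≤-trans (n*n^k≤n*nP′k+k*k*n^k n i)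
               (ℕ.+-monoʳ-≤ (n ℕ.* (n P′ i)) (ℕ.*-monoˡ-≤ (n ℕ.^ i) (n*n≤4^n i)))))) ⟩
        fromℕ (n ℕ.* (n P′ i) ℕ.+ 4 ℕ.^ i ℕ.* n ℕ.^ i) * (ι * ι ^ i) - p * ι ^ i
          ≈⟨ +-congʳ (*-congʳ (trans (fromℕ-+ (n ℕ.* (n P′ i)) (4 ℕ.^ i ℕ.* n ℕ.^ i)) (+-cong (fromℕ-* n (n P′ i)) (trans (fromℕ-* (4 ℕ.^ i) _) (*-cong (fromℕ-^ 4 i) (fromℕ-^ n i)))))) ⟩
        (fromℕ n * p + fromℕ 4 ^ i * fromℕ n ^ i) * (ι * ι ^ i) - p * ι ^ i
          ≈⟨ solve 6 (λ n p f m ι s → (n :* p :+ f :* m) :* (ι :* s) :- p :* s := n :* ι :* p :* s :+ m :* s :* f :* ι :- p :* s) refl (fromℕ n) p (fromℕ 4 ^ i) (fromℕ n ^ i) ι (ι ^ i) ⟩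
        fromℕ n * ι * p * ι ^ i + fromℕ n ^ i * ι ^ i * fromℕ 4 ^ i * ι - p * ι ^ i
          ≈⟨ +-congʳ (+-cong (*-congʳ (*-congʳ nι≈1)) (*-congʳ (*-congʳ n^iι^i≈1))) ⟩
        1# * p * ι ^ i + 1# * fromℕ 4 ^ i * ι - p * ι ^ i
          ≈⟨ solve 4 (λ p f ι s → con (+ 1) :* p :* s :+ con (+ 1) :* f :* ι :- p :* s := f :* ι) refl p (fromℕ 4 ^ i) ι (ι ^ i) ⟩
        fromℕ 4 ^ i * ι ∎

      error-part : x ^ i * (r * (1# - p * ι ^ i)) ≤ ι * (y ^ i * r)
      error-part = begin
        -- The remaining factor is nonnegative, so passing to `abs x` is sound; `x≤0⇒exp≤1` relies
        -- on the estimate for arguments that are not positive.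
        x ^ i * (r * (1# - p * ι ^ i))      ≤⟨ *-monoʳ-≤ (*-nonneg 0≤r 0≤1-pι^i) (proj₁ (^-abs x i)) ⟩
        abs x ^ i * (r * (1# - p * ι ^ i))  ≤⟨ *-monoˡ-≤ (^-nonneg i (abs-nonneg x)) (*-monoˡ-≤ 0≤r 1-pι^i≤4^iι) ⟩
        abs x ^ i * (r * (fromℕ 4 ^ i * ι)) ≈⟨ solve 4 (λ a r f ι → a :* (r :* (f :* ι)) := ι :* (f :* a :* r)) refl (abs x ^ i) r (fromℕ 4 ^ i) ι ⟩
        ι * (fromℕ 4 ^ i * abs x ^ i * r)   ≈⟨ *-congˡ (*-congʳ (^-distrib-* (fromℕ 4) (abs x) i)) ⟨
        ι * (y ^ i * r)                     ∎

  1/[1+_] : ℕ → Carrier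
  1/[1+ n ] = fromℕ (suc n) ⁻¹

  0≤1/[1+_] : ∀ n → 0# ≤ 1/[1+ n ]
  0≤1/[1+ n ] = ⁻¹-nonneg (fromℕ-nonneg (suc n))

  -- The shift by two fits the comparison ahead: the `n + 2` terms of the partial sum match the
  -- binomial expansion of exponent `n + 1`, and `1/[1+ n ]` never inverts 0.
  limit-≤ : ∀ {f l} → f ConvergesTo l → ∀ {u K} n₀ → 0# ≤ K →
            (∀ n → n₀ ℕ.≤ n → f (suc (suc n)) ≤ u + K * 1/[1+ n ]) → l ≤ u
  limit-≤ {f} {l} f→l {u} {K} n₀ 0≤K f≤ = ≤-stable λ l≰u → contradicts (≰⇒> λ l-u≤0 →
      l≰u (≤-byDifference (x≤y⇒0≤y-x l-u≤0) (solve 2 (λ l u → l :+ (con (+ 0) :- (l :- u)) := u) refl l u)))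
    where
    contradicts : ¬ 0# < l - u
    -- With `η` half of the gap, convergence and the assumed bound leave `η ≤ K / (1 + n)` for all
    -- large `n`. An index `m` with `K / η ≤ m` then gives `(1 + m) η ≤ K ≤ m η`.
    contradicts 0<l-u with N , close ← f→l (½ * (l - u)) (*-pos (⁻¹-pos (fromℕ-pos 1)) 0<l-u) =
      archimedean (K * η ⁻¹) λ m K/η≤m → 1≰0 (*-cancelˡ-≤ 0<η (begin
        η * 1#                                ≈⟨ solve 2 (λ m η → η :* con (+ 1) := (con (+ 1) :+ m) :* η :- m :* η) refl (fromℕ m) η ⟩
        fromℕ (suc m) * η - fromℕ m * η       ≤⟨ +-mono-≤ (begin
          fromℕ (suc m) * η                     ≤⟨ *-monoʳ-≤ (proj₁ 0<η) (fromℕ-mono-≤ (s≤s (ℕ.≤-trans (ℕ.m≤n⊔m n₀ m) (ℕ.m≤n⊔m N (n₀ ℕ.⊔ m))))) ⟩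
          fromℕ (suc (n m)) * η                 ≤⟨ *-monoˡ-≤ (fromℕ-nonneg (suc (n m))) (η≤K/n m) ⟩
          fromℕ (suc (n m)) * (K * 1/[1+ n m ]) ≈⟨ solve 3 (λ n k r → n :* (k :* r) := k :* (n :* r)) refl _ K _ ⟩
          K * (fromℕ (suc (n m)) * 1/[1+ n m ]) ≈⟨ trans (*-congˡ (⁻¹-inverse (fromℕ-pos (n m)))) (*-identityʳ K) ⟩
          K                                     ≈⟨ trans (*-assoc _ _ _) (trans (*-congˡ (trans (*-comm _ _) (⁻¹-inverse 0<η))) (*-identityʳ K)) ⟨
          K * η ⁻¹ * η                          ≤⟨ *-monoʳ-≤ (proj₁ 0<η) K/η≤m ⟩
          fromℕ m * η                           ∎) ≤-refl ⟩
        fromℕ m * η - fromℕ m * η             ≈⟨ solve 2 (λ η m → m :- m := η :* con (+ 0)) refl η _ ⟩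
        η * 0# ∎))
      where
      η = ½ * (l - u)
      0<η = *-pos (⁻¹-pos (fromℕ-pos 1)) 0<l-u
      n : ℕ → ℕ
      n m = N ℕ.⊔ (n₀ ℕ.⊔ m)
      η≤K/n : ∀ m → η ≤ K * 1/[1+ n m ]
      η≤K/n m = begin
        η                             ≈⟨ solve 3 (λ h l u → h :* (l :- u) := ((h :+ h) :* (l :- u) :- u) :- (h :* (l :- u) :- u)) refl ½ l u ⟩
        ((½ + ½) * (l - u) - u) - (η - u)          ≈⟨ +-congʳ (+-congʳ (trans (*-congʳ ½+½≈1) (*-identityˡ _))) ⟩
        ((l - u) - u) - (η - u)       ≈⟨ solve 4 (λ l u η f → (l :- u :- u) :- (η :- u) := (:- (f :- l) :+ f) :- u :- η) refl l u η (f (suc (suc (n m)))) ⟩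
        (- (f (suc (suc (n m))) - l) + f (suc (suc (n m)))) - u - η
          ≤⟨ +-monoˡ-≤ _ (+-monoˡ-≤ _ (+-mono-≤
               (≤-trans (-x≤abs _) (close _ (ℕ.≤-trans (ℕ.m≤m⊔n N (n₀ ℕ.⊔ m)) (ℕ.≤-trans (ℕ.n≤1+n _) (ℕ.n≤1+n _)))))
               (f≤ (n m) (ℕ.≤-trans (ℕ.m≤m⊔n n₀ m) (ℕ.m≤n⊔m N (n₀ ℕ.⊔ m)))))) ⟩
        (η + (u + K * 1/[1+ n m ])) - u - η ≈⟨ solve 3 (λ η u k → (η :+ (u :+ k)) :- u :- η := k) refl η u (K * 1/[1+ n m ]) ⟩
        K * 1/[1+ n m ] ∎

  -- The only way in which `exp` is ever estimated. Allowing an error `K / (1 + n)` in the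
  -- assumption lets the error of the series comparison and that of the probabilistic bound be
  -- merged.
  exp-≤ : ∀ {x y} → IsExp x y → ∀ {u K} n₀ → 0# ≤ K →
          (∀ n → n₀ ℕ.≤ n → (1# + x * 1/[1+ n ]) ^ suc n ≤ u + K * 1/[1+ n ]) → y ≤ u
  exp-≤ {x} {y} exp {u} {K} n₀ 0≤K bound = ≤-stable λ y≰u →
    -- The error series has argument `4 * abs x`, and `expPartialSum-bounded` asks for twice its
    -- argument to be below `k`.
    archimedean (fromℕ 2 * (fromℕ 4 * abs x)) λ k 8x≤k → y≰u
      (limit-≤ exp n₀ (+-nonneg 0≤K (*-nonneg (fromℕ-nonneg (k ℕ.^ k)) (fromℕ-nonneg 2))) λ n n₀≤n → begin
        expPartialSum x (suc (suc n))
          ≤⟨ expPartialSum≤[1+x/n]^n x (suc n) 0≤1/[1+ n ] (⁻¹-inverse (fromℕ-pos n)) ⟩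
        (1# + x * 1/[1+ n ]) ^ suc n + 1/[1+ n ] * expPartialSum (fromℕ 4 * abs x) (suc (suc n))
          ≤⟨ +-mono-≤ (bound n n₀≤n) (*-monoˡ-≤ 0≤1/[1+ n ]
               (expPartialSum-bounded k (*-nonneg (fromℕ-nonneg 4) (abs-nonneg x)) 8x≤k (suc (suc n)))) ⟩
        u + K * 1/[1+ n ] + 1/[1+ n ] * (fromℕ (k ℕ.^ k) * fromℕ 2)
          ≈⟨ solve 4 (λ u k r b → u :+ k :* r :+ r :* b := u :+ (k :+ b) :* r) refl u K 1/[1+ n ] _ ⟩
        u + (K + fromℕ (k ℕ.^ k) * fromℕ 2) * 1/[1+ n ] ∎)

-- The two-sided Chernoff bound at finite `k`.

module HoeffdingInequality {c ℓ₁ ℓ₂} (ℝ : Reals c ℓ₁ ℓ₂) where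

  open Reals ℝ hiding (zero)
  open RealProperties ℝ
  open OrderProperties ℝ
  open SumProperties ℝ
  open Concentration ℝ
  open ExponentialProperties ℝ
  open import Relation.Binary.Reasoning.PartialOrder poset

  -- Controls the cross term when a factor is split off in `1+sum-error≤product`.
  0≤r*t+y*s : ∀ {r t y s} → 0# ≤ t → - r ≤ y → y ≤ r → - t ≤ s → s ≤ t → 0# ≤ r * t + y * s
  0≤r*t+y*s {r} {t} {y} {s} 0≤t -r≤y y≤r -t≤s s≤t with total 0# y
  ... | inj₁ 0≤y = ≤-trans
    (+-nonneg (*-nonneg 0≤y (x≤y⇒0≤y-x -t≤s)) (*-nonneg (x≤y⇒0≤y-x y≤r) 0≤t))
    (≤-reflexive (solve 4 (λ r t y s → y :* (s :- :- t) :+ (r :- y) :* t := r :* t :+ y :* s) refl r t y s))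
  ... | inj₂ y≤0 = ≤-trans
    (+-nonneg (*-nonneg (x≤y⇒0≤y-x y≤0) (x≤y⇒0≤y-x s≤t)) (*-nonneg (x≤y⇒0≤y-x -r≤y) 0≤t))
    (≤-reflexive (solve 4 (λ r t y s → (con (+ 0) :- y) :* (t :- s) :+ (y :- :- r) :* t := r :* t :+ y :* s) refl r t y s))

  Within : Carrier → Carrier → Set ℓ₂
  Within r y = - r ≤ y × y ≤ r

  sum-within : ∀ {k r} {y : Vector Carrier k} → (∀ i → Within r (y i)) → Within (fromℕ k * r) (sum y)
  sum-within {k} {r} {y} within =
      (begin
        - (fromℕ k * r)      ≈⟨ solve 2 (λ k r → :- (k :* r) := k :* :- r) refl (fromℕ k) r ⟩
        fromℕ k * - r        ≈⟨ sum-const k (- r) ⟨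
        sum {k} (λ _ → - r)  ≤⟨ sum-mono-≤ (λ i → proj₁ (within i)) ⟩
        sum y                ∎)
    , (begin
        sum y                ≤⟨ sum-mono-≤ (λ i → proj₂ (within i)) ⟩
        sum {k} (λ _ → r)    ≈⟨ sum-const k r ⟩
        fromℕ k * r          ∎)

  -- A product inequality of Weierstrass type for terms of mixed sign: all terms of order two and
  -- higher together cost at most `(k r)²`, provided that `k r ≤ 1`.
  1+sum-error≤product : ∀ {k r} (y : Vector Carrier k) → 0# ≤ r → fromℕ k * r ≤ 1# →
    (∀ i → Within r (y i)) →
    1# + sum y - fromℕ k * r * (fromℕ k * r) ≤ product (λ i → 1# + y i)
  1+sum-error≤product {zero}  {r} y 0≤r kr≤1 within = ≤-reflexive
    (solve 1 (λ r → con (+ 1) :+ con (+ 0) :- con (+ 0) :* r :* (con (+ 0) :* r) := con (+ 1)) refl r)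
  1+sum-error≤product {suc k} {r} y 0≤r [1+k]r≤1 within = begin
    1# + (y zero + s) - fromℕ (suc k) * r * (fromℕ (suc k) * r)
      -- The error may grow by `(2 k + 1) r²`. One `k r²` pays for the cross term `y zero * s`;
      -- another pays for `(k r)² * y zero`, which is at most `k r²` because `k r ≤ 1`; a single
      -- `r²` is left over.
      ≤⟨ ≤-byDifference
           (+-nonneg (+-nonneg
             (0≤r*t+y*s 0≤kr (proj₁ (within zero)) (proj₂ (within zero)) (proj₁ s-within) (proj₂ s-within))
             (*-nonneg (*-nonneg 0≤kr 0≤kr) (x≤y⇒0≤y-x (proj₂ (within zero)))))
             (*-nonneg (square-nonneg r) (+-nonneg (*-nonneg (fromℕ-nonneg k) (x≤y⇒0≤y-x kr≤1)) 0≤1)))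
           (solve 4 (λ y s k r →
               con (+ 1) :+ (y :+ s) :- (con (+ 1) :+ k) :* r :* ((con (+ 1) :+ k) :* r)
               :+ (r :* (k :* r) :+ y :* s :+ k :* r :* (k :* r) :* (r :- y)
               :+ r :* r :* (k :* (con (+ 1) :- k :* r) :+ con (+ 1)))
               := (con (+ 1) :+ y) :* (con (+ 1) :+ s :- k :* r :* (k :* r)))
             refl (y zero) s (fromℕ k) r) ⟩
    (1# + y zero) * (1# + s - fromℕ k * r * (fromℕ k * r))
      ≤⟨ *-monoˡ-≤ 0≤1+y₀ (1+sum-error≤product (λ i → y (suc i)) 0≤r kr≤1 (λ i → within (suc i))) ⟩
    (1# + y zero) * product (λ i → 1# + y (suc i)) ∎
    where
    s = sum λ i → y (suc i)
    0≤kr = *-nonneg (fromℕ-nonneg k) 0≤r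
    kr≤1 = ≤-trans (≤-byDifference 0≤r (solve 2 (λ k r → k :* r :+ r := (con (+ 1) :+ k) :* r) refl (fromℕ k) r)) [1+k]r≤1
    r≤1 = ≤-trans (≤-byDifference 0≤kr (solve 2 (λ k r → r :+ k :* r := (con (+ 1) :+ k) :* r) refl (fromℕ k) r)) [1+k]r≤1
    s-within = sum-within λ i → within (suc i)
    0≤1+y₀ : 0# ≤ 1# + y zero
    0≤1+y₀ = ≤-trans (+-nonneg (x≤y⇒0≤y-x r≤1) (x≤y⇒0≤y-x (proj₁ (within zero))))
      (≤-reflexive (solve 2 (λ r y → con (+ 1) :- r :+ (y :- :- r) := con (+ 1) :+ y) refl r (y zero)))

  ^-comm-^ : ∀ x j k → (x ^ j) ^ k ≈ (x ^ k) ^ j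
  ^-comm-^ x j k = begin-equality
    (x ^ j) ^ k     ≈⟨ ^-assocʳ x j k ⟩
    x ^ (j ℕ.* k)   ≡⟨ ≡.cong (x ^_) (ℕ.*-comm j k) ⟩
    x ^ (k ℕ.* j)   ≈⟨ ^-assocʳ x k j ⟨
    (x ^ k) ^ j     ∎

  module _ {n} (p X : Vector Carrier n) (0≤p : ∀ i → 0# ≤ p i) (∑p≈1 : sum p ≈ 1#)
           (X-within : ∀ i → Within 1# (X i)) (m : ℕ) where

    μ : Carrier
    μ = sum λ i → p i * X i

    deviation : (Fin m → Fin n) → Carrier
    deviation ω = sum λ l → X (ω l) - μ

    private
      -X : Vector Carrier n
      -X i = - X i

      X²≤1 : ∀ {x} → Within 1# x → x * x ≤ 1#
      X²≤1 {x} (-1≤x , x≤1) = ≤-byDifference (*-nonneg (x≤y⇒0≤y-x -1≤x) (x≤y⇒0≤y-x x≤1))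
        (solve 1 (λ x → x :* x :+ (x :- :- con (+ 1)) :* (con (+ 1) :- x) := con (+ 1)) refl x)

      -within : ∀ {r y} → Within r y → Within r (- y)
      -within (-r≤y , y≤r) = -‿anti-≤ y≤r , ≤-trans (-‿anti-≤ -r≤y) (≤-reflexive (solve 1 (λ r → :- :- r := r) refl _))

      weighted-≤ : ∀ {f g : Vector Carrier n} → (∀ i → f i ≤ g i) → sum (λ i → p i * f i) ≤ sum (λ i → p i * g i)
      weighted-≤ f≤g = sum-mono-≤ λ i → *-monoˡ-≤ (0≤p i) (f≤g i)

      weighted-const : ∀ x → sum (λ i → p i * x) ≈ x
      weighted-const x = trans (sym (*-distribʳ-sum x p)) (trans (*-congʳ ∑p≈1) (*-identityˡ x))

      μ-within : Within 1# μ
      μ-within = ≤-trans (≤-reflexive (sym (weighted-const (- 1#)))) (weighted-≤ λ i → proj₁ (X-within i))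
               , ≤-trans (weighted-≤ λ i → proj₂ (X-within i)) (≤-reflexive (weighted-const 1#))

      Y-within : ∀ i → Within (1# + 1#) (X i - μ)
      Y-within i with -1≤X , X≤1 ← X-within i | -1≤μ , μ≤1 ← μ-within =
          ≤-trans (≤-reflexive (solve 0 (:- (con (+ 1) :+ con (+ 1)) := :- con (+ 1) :+ :- con (+ 1)) refl))
            (+-mono-≤ -1≤X (-‿anti-≤ μ≤1))
        , +-mono-≤ X≤1 (proj₂ (-within μ-within))

      mean-neg : sum (λ i → p i * -X i) ≈ - μ
      mean-neg = trans (sum-cong-≋ λ i → solve 2 (λ p x → p :* :- x := :- (p :* x)) refl (p i) (X i))
        (sum-neg λ i → p i * X i)

    module _ {ε} (0≤ε : 0# ≤ ε) (ε≤1 : ε ≤ 1#) (k : ℕ) {ι} (0≤ι : 0# ≤ ι) (kι≈1 : fromℕ k * ι ≈ 1#)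
             (2mι≤1 : fromℕ m * ((1# + 1#) * ι) ≤ 1#) (2ι≤1 : (1# + 1#) * ι ≤ 1#) where

      private
        -- `r` bounds the size of `h` times a deviation, as deviations are at most 2 and `ε ≤ 1#`.
        -- `z` is half of `h²`, so that `k z` is `ε² / 2k`.
        h r z : Carrier
        h = ε * ι
        r = (1# + 1#) * ι
        z = ½ * (ε * ε) * (ι * ι)

        0≤h = *-nonneg 0≤ε 0≤ι
        0≤r = *-nonneg (+-nonneg 0≤1 0≤1) 0≤ι
        0≤z = *-nonneg (*-nonneg 0≤½ (square-nonneg ε)) (square-nonneg ι)

        h²≈2z : h * h ≈ z + z
        h²≈2z = begin-equality
          h * h                            ≈⟨ *-identityˡ _ ⟨
          1# * (h * h)                     ≈⟨ *-congʳ ½+½≈1 ⟨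
          (½ + ½) * (h * h)                ≈⟨ solve 3 (λ a e i → (a :+ a) :* (e :* i :* (e :* i)) := a :* (e :* e) :* (i :* i) :+ a :* (e :* e) :* (i :* i)) refl ½ ε ι ⟩
          z + z                            ∎

        scaled-within : ∀ {y} → Within (1# + 1#) y → Within r (h * y)
        scaled-within {y} (-2≤y , y≤2) =
            ≤-trans (-‿anti-≤ h2≤r) (≤-trans (≤-reflexive (solve 2 (λ h t → :- (h :* t) := h :* :- t) refl h (1# + 1#))) (*-monoˡ-≤ 0≤h -2≤y))
          , ≤-trans (*-monoˡ-≤ 0≤h y≤2) h2≤r
          where
          h2≤r : h * (1# + 1#) ≤ r
          h2≤r = begin
            ε * ι * (1# + 1#)    ≈⟨ solve 3 (λ e i t → e :* i :* t := e :* (t :* i)) refl ε ι (1# + 1#) ⟩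
            ε * ((1# + 1#) * ι)  ≤⟨ x≤1⇒x*y≤y 0≤r ε≤1 ⟩
            (1# + 1#) * ι        ∎

        0≤1+ : ∀ {y} → Within r y → 0# ≤ 1# + y
        0≤1+ {y} (-r≤y , _) = ≤-trans (+-nonneg (x≤y⇒0≤y-x 2ι≤1) (x≤y⇒0≤y-x -r≤y))
          (≤-reflexive (solve 2 (λ r y → con (+ 1) :- r :+ (y :- :- r) := con (+ 1) :+ y) refl r y))

        -- Stated for a general `Z` because the lower tail of `X` is the upper tail of `-X`. The
        -- masses and the powers merge into one factor per draw, to which `sum-product` applies.
        tail-moment : ∀ (Z : Vector Carrier n) ν → sum (λ i → p i * Z i) ≈ ν → (∀ i → Within 1# (Z i)) →
          (∀ i → Within (1# + 1#) (Z i - ν)) →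
          sum {n ℕ.^ m} (λ t → let ω = finToFun {n} {m} t in
            product (λ l → p (ω l)) * product (λ l → (1# + h * (Z (ω l) - ν)) ^ k))
          ≤ ((1# + fromℕ k * z) ^ k) ^ m
        tail-moment Z ν mean Z-within Z-ν-within = begin
          sum {n ℕ.^ m} (λ t → let ω = finToFun {n} {m} t in
            product (λ l → p (ω l)) * product (λ l → (1# + h * (Z (ω l) - ν)) ^ k))
            ≈⟨ sum-cong-≋ {n ℕ.^ m} (λ t → product-distrib-* (λ l → p (finToFun {n} {m} t l)) _) ⟨
          sum {n ℕ.^ m} (λ t → product (λ l → f (finToFun {n} {m} t l)))
            ≈⟨ sum-product f m ⟩
          sum f ^ m
            ≤⟨ ^-mono-≤ m (sum-nonneg λ i → *-nonneg (0≤p i) (^-nonneg k (0≤1+hY i)))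
                 (hoeffding-lemma p Z ν h 0≤p ∑p≈1 (λ i → X²≤1 (Z-within i)) mean 0≤h 0≤1+hY 0≤z h²≈2z k) ⟩
          ((1# + fromℕ k * z) ^ k) ^ m ∎
          where
          f : Vector Carrier n
          f i = p i * (1# + h * (Z i - ν)) ^ k
          0≤1+hY : ∀ i → 0# ≤ 1# + h * (Z i - ν)
          0≤1+hY i = 0≤1+ (scaled-within (Z-ν-within i))

        threshold : Carrier
        threshold = 1# + h * (fromℕ m * ε) - fromℕ m * r * (fromℕ m * r)

        0≤threshold : 0# ≤ threshold
        0≤threshold = ≤-trans
          (+-nonneg (*-nonneg 0≤h (*-nonneg (fromℕ-nonneg m) 0≤ε)) (x≤y⇒0≤y-x (≤-trans (*-mono-≤ 0≤mr 0≤mr 2mι≤1 2mι≤1) (≤-reflexive (*-identityˡ 1#)))))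
          (≤-reflexive (solve 2 (λ a b → a :+ (con (+ 1) :- b) := con (+ 1) :+ a :- b) refl (h * (fromℕ m * ε)) (fromℕ m * r * (fromℕ m * r))))
          where 0≤mr = *-nonneg (fromℕ-nonneg m) 0≤r

        threshold-≤ : ∀ (D : Vector Carrier m) → (∀ l → Within (1# + 1#) (D l)) → fromℕ m * ε ≤ sum D →
                      threshold ^ k ≤ product (λ l → (1# + h * D l) ^ k)
        threshold-≤ D D-within mε≤D = begin
          threshold ^ k
            ≤⟨ ^-mono-≤ k 0≤threshold (begin
              threshold
                ≤⟨ +-monoˡ-≤ _ (+-mono-≤ ≤-refl (*-monoˡ-≤ 0≤h mε≤D)) ⟩
              1# + h * sum D - fromℕ m * r * (fromℕ m * r)
                ≈⟨ +-congʳ (+-congˡ (*-distribˡ-sum h D)) ⟩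
              1# + sum (λ l → h * D l) - fromℕ m * r * (fromℕ m * r)
                ≤⟨ 1+sum-error≤product (λ l → h * D l) 0≤r 2mι≤1 (λ l → scaled-within (D-within l)) ⟩
              product (λ l → 1# + h * D l) ∎) ⟩
          product (λ l → 1# + h * D l) ^ k
            ≈⟨ product-^ (λ l → 1# + h * D l) k ⟨
          product (λ l → (1# + h * D l) ^ k) ∎

      -- Markov's inequality is applied once, to the sum `W⁺ + W⁻`, which reaches the threshold on
      -- either tail; each summand contributes one moment bound, whence the factor 2.
      chernoff-bound : ∀ {q} {P : Pred (Fin m → Fin n) q} (P? : Decidable P) →
        (∀ ω → ¬ P ω → (fromℕ m * ε ≤ deviation ω) ⊎ (fromℕ m * ε ≤ - deviation ω)) →
        (1# + h * (fromℕ m * ε) - fromℕ m * r * (fromℕ m * r)) ^ k * (1# - Pr ℝ p m P?) ≤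
        (1# + 1#) * ((1# + fromℕ k * z) ^ k) ^ m
      chernoff-bound {P = P} P? tail = begin
        threshold ^ k * (1# - Pr ℝ p m P?)
          ≤⟨ markov p m P? 0≤p ∑p≈1 W 0≤W x≤W ⟩
        sum {n ℕ.^ m} (λ t → let ω = finToFun {n} {m} t in product (λ l → p (ω l)) * W ω)
          ≈⟨ sum-cong-≋ {n ℕ.^ m} (λ t → distribˡ _ _ _) ⟩
        sum {n ℕ.^ m} (λ t → let ω = finToFun {n} {m} t in
          product (λ l → p (ω l)) * W⁺ ω + product (λ l → p (ω l)) * W⁻ ω)
          ≈⟨ ∑-distrib-+ {n ℕ.^ m} _ _ ⟩
        sum {n ℕ.^ m} (λ t → let ω = finToFun {n} {m} t in product (λ l → p (ω l)) * W⁺ ω) +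
        sum {n ℕ.^ m} (λ t → let ω = finToFun {n} {m} t in product (λ l → p (ω l)) * W⁻ ω)
          ≤⟨ +-mono-≤ (tail-moment X μ refl X-within Y-within)
                      (tail-moment -X (- μ) mean-neg (λ i → -within (X-within i)) -Y-within) ⟩
        ((1# + fromℕ k * z) ^ k) ^ m + ((1# + fromℕ k * z) ^ k) ^ m
          ≈⟨ solve 1 (λ a → a :+ a := (con (+ 1) :+ con (+ 1)) :* a) refl _ ⟩
        (1# + 1#) * ((1# + fromℕ k * z) ^ k) ^ m ∎
        where
        W⁺ W⁻ W : (Fin m → Fin n) → Carrier
        W⁺ ω = product λ l → (1# + h * (X (ω l) - μ)) ^ k
        W⁻ ω = product λ l → (1# + h * (-X (ω l) - - μ)) ^ k
        W ω = W⁺ ω + W⁻ ω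

        -Y-within : ∀ i → Within (1# + 1#) (-X i - - μ)
        -Y-within i with -2≤-Y , -Y≤2 ← -within (Y-within i) = ≤-trans -2≤-Y (≤-reflexive e) , ≤-trans (≤-reflexive (sym e)) -Y≤2
          where
          e : - (X i - μ) ≈ -X i - - μ
          e = solve 2 (λ x μ → :- (x :- μ) := :- x :- :- μ) refl (X i) μ

        0≤W⁺ : ∀ ω → 0# ≤ W⁺ ω
        0≤W⁺ ω = product-nonneg λ l → ^-nonneg k (0≤1+ (scaled-within (Y-within (ω l))))
        0≤W⁻ : ∀ ω → 0# ≤ W⁻ ω
        0≤W⁻ ω = product-nonneg λ l → ^-nonneg k (0≤1+ (scaled-within (-Y-within (ω l))))
        0≤W : ∀ ω → 0# ≤ W ω
        0≤W ω = +-nonneg (0≤W⁺ ω) (0≤W⁻ ω)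

        -deviation : ∀ ω → - deviation ω ≈ sum λ l → -X (ω l) - - μ
        -deviation ω = trans (sym (sum-neg λ l → X (ω l) - μ))
          (sum-cong-≋ λ l → solve 2 (λ x μ → :- (x :- μ) := :- x :- :- μ) refl (X (ω l)) μ)

        x≤W : ∀ ω → ¬ P ω → threshold ^ k ≤ W ω
        x≤W ω ¬Pω with tail ω ¬Pω
        ... | inj₁ upper = ≤-trans (threshold-≤ _ (λ l → Y-within (ω l)) upper) (≤-byDifference (0≤W⁻ ω) refl)
        ... | inj₂ lower = ≤-trans (threshold-≤ _ (λ l → -Y-within (ω l)) (≤-trans lower (≤-reflexive (-deviation ω))))
          (≤-byDifference (0≤W⁺ ω) (+-comm _ _))

-- From the Chernoff bound to a bound on `(1 + L / k) ^ k`.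

module TailArithmetic {c ℓ₁ ℓ₂} (ℝ : Reals c ℓ₁ ℓ₂) where

  open Reals ℝ hiding (zero)
  open RealProperties ℝ
  open OrderProperties ℝ
  open ExponentialProperties ℝ
  open HoeffdingInequality ℝ
  open import Relation.Binary.Reasoning.PartialOrder poset

  ½≤1 : ½ ≤ 1#
  ½≤1 = ≤-byDifference 0≤½ ½+½≈1

  -- Multiplying by (1 - b) ^ (m k), where b = ε² ι / 2, cancels the moment bound.
  chernoff⇒power : ∀ {ε ι L q} m k → let K = fromℕ 6 * (fromℕ m * fromℕ m) in
    0# ≤ ε → ε ≤ 1# → 0# ≤ ι → ι ≤ 1# → fromℕ k * ι ≈ 1# → K * ι ≤ ½ →
    0# ≤ L → L ≤ fromℕ m * (½ * (ε * ε)) → 0# < q →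
    (1# + ε * ι * (fromℕ m * ε) - fromℕ m * ((1# + 1#) * ι) * (fromℕ m * ((1# + 1#) * ι))) ^ k * q
      ≤ (1# + 1#) * ((1# + fromℕ k * (½ * (ε * ε) * (ι * ι))) ^ k) ^ m →
    (1# + L * ι) ^ k ≤ fromℕ 2 * q ⁻¹ + fromℕ 4 * K * q ⁻¹ * ι
  chernoff⇒power {ε} {ι} {L} {q} m k 0≤ε ε≤1 0≤ι ι≤1 kι≈1 Kι≤½ 0≤L L≤ 0<q chernoff = begin
    v ^ k                       ≈⟨ trans (sym (*-identityˡ _)) (*-congʳ (trans (sym (⁻¹-inverse 0<q)) (*-comm _ _))) ⟩
    q ⁻¹ * q * v ^ k            ≈⟨ *-assoc _ _ _ ⟩
    q ⁻¹ * Q                    ≤⟨ *-monoˡ-≤ (⁻¹-nonneg 0≤q) Q≤2+4Kι ⟩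
    q ⁻¹ * (fromℕ 2 + fromℕ 4 * (K * ι)) ≈⟨ solve 5 (λ r t f k i → r :* (t :+ f :* (k :* i)) := t :* r :+ f :* k :* r :* i) refl (q ⁻¹) (fromℕ 2) (fromℕ 4) K ι ⟩
    fromℕ 2 * q ⁻¹ + fromℕ 4 * K * q ⁻¹ * ι ∎
    where
    M K b a t v w S Q : Carrier
    M = fromℕ m
    K = fromℕ 6 * (M * M)
    b = ½ * (ε * ε) * ι
    a = M * b
    t = 1# + ε * ι * (M * ε) - M * ((1# + 1#) * ι) * (M * ((1# + 1#) * ι))
    v = 1# + L * ι
    w = 1# - K * (ι * ι)
    S = (1# - b) ^ m
    Q = q * v ^ k

    0≤q = proj₁ 0<q
    0≤M = fromℕ-nonneg m
    0≤K = *-nonneg (fromℕ-nonneg 6) (*-nonneg 0≤M 0≤M)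
    0≤b = *-nonneg (*-nonneg 0≤½ (square-nonneg ε)) 0≤ι
    0≤a = *-nonneg 0≤M 0≤b
    0≤v = +-nonneg 0≤1 (*-nonneg 0≤L 0≤ι)

    ½ε²≤1 : ½ * (ε * ε) ≤ 1#
    ½ε²≤1 = ≤-trans (x≤1⇒x*y≤y (square-nonneg ε) ½≤1) (≤-trans (x≤1⇒x*y≤y 0≤ε ε≤1) ε≤1)

    b≤ι : b ≤ ι
    b≤ι = x≤1⇒x*y≤y 0≤ι ½ε²≤1

    b≤1 = ≤-trans b≤ι ι≤1

    a≤Mι : a ≤ M * ι
    a≤Mι = *-monoˡ-≤ 0≤M b≤ι

    Lι≤a : L * ι ≤ a
    Lι≤a = ≤-trans (*-monoʳ-≤ 0≤ι L≤) (≤-reflexive (*-assoc M _ ι))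

    kz≈b : fromℕ k * (½ * (ε * ε) * (ι * ι)) ≈ b
    kz≈b = trans (solve 4 (λ k h e i → k :* (h :* (e :* e) :* (i :* i)) := k :* i :* (h :* (e :* e) :* i)) refl (fromℕ k) ½ ε ι)
      (trans (*-congʳ kι≈1) (*-identityˡ b))

    2a≈ : a + a ≈ ε * ι * (M * ε)
    2a≈ = trans (solve 4 (λ m h e i → m :* (h :* (e :* e) :* i) :+ m :* (h :* (e :* e) :* i) := (h :+ h) :* (e :* i :* (m :* e))) refl M ½ ε ι)
      (trans (*-congʳ ½+½≈1) (*-identityˡ _))

    Kι≤1 = ≤-trans Kι≤½ ½≤1

    Kι²≤1 : K * (ι * ι) ≤ 1#
    Kι²≤1 = ≤-trans (≤-reflexive (sym (*-assoc K ι ι))) (≤-trans (x≤1⇒x*y≤y 0≤ι Kι≤1) ι≤1)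

    0≤w = x≤y⇒0≤y-x Kι²≤1

    t≈ : t ≈ 1# + (a + a) - fromℕ 4 * (M * M * (ι * ι))
    t≈ = +-cong (+-congˡ (sym 2a≈)) (-‿cong (solve 2 (λ m i → m :* ((con (+ 1) :+ con (+ 1)) :* i) :* (m :* ((con (+ 1) :+ con (+ 1)) :* i))
      := (con (+ 1) :+ (con (+ 1) :+ (con (+ 1) :+ (con (+ 1) :+ con (+ 0))))) :* (m :* m :* (i :* i))) refl M ι))

    -- The origin of the constant 6. Expanding `t * (1# - a)` gives `1 + a − 2 a² − 4 M² ι²` plus a
    -- nonnegative term, and `a ≤ M ι` turns the loss into at most `6 M² ι²`, which is `K ι²`.
    vw≤t[1-a] : v * w ≤ t * (1# - a)
    vw≤t[1-a] = ≤-trans (≤-byDifference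
        (+-nonneg (x≤y⇒0≤y-x Lι≤a) (+-nonneg
          (+-nonneg (*-nonneg x≥0 y≥0) (*-nonneg x≥0 y≥0))
          (+-nonneg (*-nonneg (*-nonneg (fromℕ-nonneg 4) (*-nonneg (*-nonneg 0≤M 0≤M) (square-nonneg ι))) 0≤a)
                    (*-nonneg (*-nonneg 0≤L 0≤ι) (*-nonneg 0≤K (square-nonneg ι))))))
        (solve 4 (λ M i L a → let four = con (+ 1) :+ (con (+ 1) :+ (con (+ 1) :+ (con (+ 1) :+ con (+ 0))))
                                  K = (con (+ 1) :+ (con (+ 1) :+ four)) :* (M :* M) in
          (con (+ 1) :+ L :* i) :* (con (+ 1) :- K :* (i :* i))
          :+ (a :- L :* i :+ ((M :* i :- a) :* (M :* i :+ a) :+ (M :* i :- a) :* (M :* i :+ a)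
          :+ (four :* (M :* M :* (i :* i)) :* a :+ L :* i :* (K :* (i :* i)))))
          := (con (+ 1) :+ (a :+ a) :- four :* (M :* M :* (i :* i))) :* (con (+ 1) :- a)) refl M ι L a))
      (≤-reflexive (*-congʳ (sym t≈)))
      where
      x≥0 = x≤y⇒0≤y-x a≤Mι
      y≥0 = +-nonneg (*-nonneg 0≤M 0≤ι) 0≤a

    0≤t : 0# ≤ t
    0≤t = ≤-trans (+-nonneg (+-nonneg 0≤a 0≤a) (x≤y⇒0≤y-x (begin
        fromℕ 4 * (M * M * (ι * ι))  ≤⟨ *-monoʳ-≤ (*-nonneg (*-nonneg 0≤M 0≤M) (square-nonneg ι)) (fromℕ-mono-≤ (ℕ.m≤m+n 4 2)) ⟩
        fromℕ 6 * (M * M * (ι * ι))  ≈⟨ *-assoc _ _ _ ⟨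
        K * (ι * ι)                  ≤⟨ Kι²≤1 ⟩
        1#                           ∎)))
      (≤-reflexive (trans (solve 2 (λ a f → a :+ a :+ (con (+ 1) :- f) := con (+ 1) :+ (a :+ a) :- f) refl a _) (sym t≈)))

    vw≤tS : v * w ≤ t * S
    vw≤tS = ≤-trans vw≤t[1-a] (*-monoˡ-≤ 0≤t (bernoulli m 0≤b b≤1))

    0≤1-b = x≤y⇒0≤y-x b≤1

    moment*S^k≤1 : ((1# + fromℕ k * (½ * (ε * ε) * (ι * ι))) ^ k) ^ m * S ^ k ≤ 1#
    moment*S^k≤1 = begin
      ((1# + fromℕ k * (½ * (ε * ε) * (ι * ι))) ^ k) ^ m * S ^ k
        ≈⟨ *-cong (^-congˡ m (^-congˡ k (+-congˡ kz≈b))) (^-comm-^ (1# - b) m k) ⟩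
      ((1# + b) ^ k) ^ m * ((1# - b) ^ k) ^ m
        ≈⟨ trans (sym (^-distrib-* _ _ m)) (^-congˡ m (sym (^-distrib-* _ _ k))) ⟩
      (((1# + b) * (1# - b)) ^ k) ^ m
        ≤⟨ ^-≤1 m (^-nonneg k 0≤[1+b][1-b]) (^-≤1 k 0≤[1+b][1-b]
             (≤-byDifference (square-nonneg b) (solve 1 (λ b → (con (+ 1) :+ b) :* (con (+ 1) :- b) :+ b :* b := con (+ 1)) refl b))) ⟩
      1# ∎
      where 0≤[1+b][1-b] = *-nonneg (+-nonneg 0≤1 0≤b) 0≤1-b

    -- Each of the `k` factors `v` is corrected by `w`; as `k ι` is 1, the losses `K ι²` add up to
    -- `K ι`.
    Q[1-Kι]≤2 : Q * (1# - K * ι) ≤ 1# + 1#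
    Q[1-Kι]≤2 = begin
      Q * (1# - K * ι)
        ≈⟨ *-congˡ (+-congˡ (-‿cong (trans (trans (sym (*-identityˡ _)) (*-congʳ (sym kι≈1))) (solve 3 (λ k i K → k :* i :* (K :* i) := k :* (K :* (i :* i))) refl (fromℕ k) ι K)))) ⟩
      Q * (1# - fromℕ k * (K * (ι * ι)))
        ≤⟨ *-monoˡ-≤ (*-nonneg 0≤q (^-nonneg k 0≤v)) (bernoulli k (*-nonneg 0≤K (square-nonneg ι)) Kι²≤1) ⟩
      q * v ^ k * w ^ k
        ≈⟨ trans (*-assoc _ _ _) (*-congˡ (sym (^-distrib-* v w k))) ⟩
      q * (v * w) ^ k
        ≤⟨ *-monoˡ-≤ 0≤q (^-mono-≤ k (*-nonneg 0≤v 0≤w) vw≤tS) ⟩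
      q * (t * S) ^ k
        ≈⟨ trans (*-congˡ (^-distrib-* t S k)) (solve 3 (λ q t s → q :* (t :* s) := t :* q :* s) refl q (t ^ k) (S ^ k)) ⟩
      t ^ k * q * S ^ k
        ≤⟨ *-monoʳ-≤ (^-nonneg k (^-nonneg m 0≤1-b)) chernoff ⟩
      (1# + 1#) * ((1# + fromℕ k * (½ * (ε * ε) * (ι * ι))) ^ k) ^ m * S ^ k
        ≈⟨ *-assoc _ _ _ ⟩
      (1# + 1#) * (((1# + fromℕ k * (½ * (ε * ε) * (ι * ι))) ^ k) ^ m * S ^ k)
        ≤⟨ *-monoˡ-≤ (+-nonneg 0≤1 0≤1) moment*S^k≤1 ⟩
      (1# + 1#) * 1#
        ≈⟨ *-identityʳ _ ⟩
      1# + 1# ∎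

    0≤Q = *-nonneg 0≤q (^-nonneg k 0≤v)

    -- A crude bound from `K ι ≤ ½`, fed back into `Q = Q (1 − K ι) + Q K ι` to obtain the sharp
    -- leading constant 2 without dividing by `1# - K * ι`.
    Q≤4 : Q ≤ fromℕ 4
    Q≤4 = begin
      Q                              ≈⟨ trans (sym (*-identityʳ Q)) (*-congˡ (sym ½+½≈1)) ⟩
      Q * (½ + ½)                    ≈⟨ distribˡ Q ½ ½ ⟩
      Q * ½ + Q * ½                  ≤⟨ +-mono-≤ Q½≤2 Q½≤2 ⟩
      (1# + 1#) + (1# + 1#)          ≈⟨ solve 0 (con (+ 1) :+ con (+ 1) :+ (con (+ 1) :+ con (+ 1)) := con (+ 1) :+ (con (+ 1) :+ (con (+ 1) :+ (con (+ 1) :+ con (+ 0))))) refl ⟩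
      fromℕ 4                        ∎
      where
      ½≤1-Kι : ½ ≤ 1# - K * ι
      ½≤1-Kι = begin
        ½            ≈⟨ solve 1 (λ h → h := h :+ h :- h) refl ½ ⟩
        ½ + ½ - ½    ≈⟨ +-congʳ ½+½≈1 ⟩
        1# - ½       ≤⟨ +-mono-≤ ≤-refl (-‿anti-≤ Kι≤½) ⟩
        1# - K * ι   ∎
      Q½≤2 = ≤-trans (*-monoˡ-≤ 0≤Q ½≤1-Kι) Q[1-Kι]≤2

    Q≤2+4Kι : Q ≤ fromℕ 2 + fromℕ 4 * (K * ι)
    Q≤2+4Kι = begin
      Q                                  ≈⟨ solve 2 (λ q k → q := q :* (con (+ 1) :- k) :+ q :* k) refl Q (K * ι) ⟩
      Q * (1# - K * ι) + Q * (K * ι)     ≤⟨ +-mono-≤ Q[1-Kι]≤2 (*-monoʳ-≤ (*-nonneg 0≤K 0≤ι) Q≤4) ⟩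
      (1# + 1#) + fromℕ 4 * (K * ι)      ≈⟨ +-congʳ (+-congˡ (+-identityʳ 1#)) ⟨
      fromℕ 2 + fromℕ 4 * (K * ι)        ∎

-- Hoeffding's inequality in the limit, and the sample size.

module _ {c ℓ₁ ℓ₂} (ℝ : Reals c ℓ₁ ℓ₂) where

  open Reals ℝ hiding (zero)
  open RealProperties ℝ
  open OrderProperties ℝ
  open SumProperties ℝ
  open ExponentialProperties ℝ
  open HoeffdingInequality ℝ
  open TailArithmetic ℝ
  open import Relation.Binary.Reasoning.PartialOrder poset

  m/[1+n]≤1 : ∀ {m n} → m ℕ.≤ suc n → fromℕ m * 1/[1+ n ] ≤ 1#
  m/[1+n]≤1 {m} {n} m≤1+n = ≤-trans
    (*-monoʳ-≤ (⁻¹-nonneg (fromℕ-nonneg (suc n))) (fromℕ-mono-≤ m≤1+n))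
    (≤-reflexive (⁻¹-inverse (fromℕ-pos n)))

  -- Yields `L > 0`, since `exp L` is `2 / δ > 1`. Once `n` exceeds `- x`, the base
  -- `1 + x / (1 + n)` lies between 0 and 1, and so do its powers.
  x≤0⇒exp≤1 : ∀ {x y} → IsExp x y → x ≤ 0# → y ≤ 1#
  x≤0⇒exp≤1 {x} {y} exp x≤0 = ≤-stable λ y≰1 → archimedean (- x) λ N -x≤N →
    y≰1 (exp-≤ exp {K = 0#} N ≤-refl λ n N≤n → begin
      (1# + x * 1/[1+ n ]) ^ suc n  ≤⟨ ^-≤1 (suc n) (0≤ -x≤N N≤n) (≤1 n) ⟩
      1#                            ≈⟨ solve 1 (λ r → con (+ 1) := con (+ 1) :+ con (+ 0) :* r) refl 1/[1+ n ] ⟩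
      1# + 0# * 1/[1+ n ]           ∎)
    where
    ≤1 : ∀ n → 1# + x * 1/[1+ n ] ≤ 1#
    ≤1 n = ≤-byDifference (*-nonneg (x≤y⇒0≤y-x x≤0) 0≤1/[1+ n ])
      (solve 2 (λ x r → con (+ 1) :+ x :* r :+ (con (+ 0) :- x) :* r := con (+ 1)) refl x 1/[1+ n ])
    0≤ : ∀ {N n} → - x ≤ fromℕ N → N ℕ.≤ n → 0# ≤ 1# + x * 1/[1+ n ]
    0≤ {N} {n} -x≤N N≤n = ≤-trans
      (x≤y⇒0≤y-x (≤-trans (*-monoʳ-≤ 0≤1/[1+ n ] -x≤N) (m/[1+n]≤1 (ℕ.≤-trans N≤n (ℕ.n≤1+n n)))))
      (≤-reflexive (solve 2 (λ x r → con (+ 1) :- :- x :* r := con (+ 1) :+ x :* r) refl x 1/[1+ n ]))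

  -- The bound has the form `y ≤ 2 / q`, with `y` being `exp L`, because `exp-≤` takes the limit on
  -- that side; this is why `q` must be positive.
  hoeffding : ∀ {n} (p X : Vector Carrier n) →
    (0≤p : ∀ i → 0# ≤ p i) (∑p≈1 : sum p ≈ 1#) (X-within : ∀ i → Within 1# (X i)) →
    ∀ m {ε} → 0# ≤ ε → ε ≤ 1# →
    ∀ {q} {P : Pred (Fin m → Fin n) q} (P? : Decidable P) →
    let D = deviation p X 0≤p ∑p≈1 X-within m in
    (∀ ω → ¬ P ω → (fromℕ m * ε ≤ D ω) ⊎ (fromℕ m * ε ≤ - D ω)) →
    ∀ {L y} → IsExp L y → 0# ≤ L → L ≤ fromℕ m * (½ * (ε * ε)) →
    0# < 1# - Pr ℝ p m P? → y ≤ fromℕ 2 * (1# - Pr ℝ p m P?) ⁻¹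
  hoeffding p X 0≤p ∑p≈1 X-within m {ε} 0≤ε ε≤1 P? tail {L} exp 0≤L L≤ 0<q =
    exp-≤ exp n₀ (*-nonneg (*-nonneg (fromℕ-nonneg 4) 0≤K) (⁻¹-nonneg (proj₁ 0<q))) λ n n₀≤n →
      let 0≤ι = 0≤1/[1+ n ]
          kι≈1 = ⁻¹-inverse (fromℕ-pos n)
          n₀≤1+n = ℕ.≤-trans n₀≤n (ℕ.n≤1+n n)
      in chernoff⇒power m (suc n) 0≤ε ε≤1 0≤ι
           (≤-trans (≤-reflexive (solve 1 (λ r → r := (con (+ 1) :+ con (+ 0)) :* r) refl 1/[1+ n ])) (m/[1+n]≤1 {n = n} (s≤s z≤n)))
           kι≈1 (Kι≤½ n n₀≤1+n) 0≤L L≤ 0<q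
           (chernoff-bound p X 0≤p ∑p≈1 X-within m 0≤ε ε≤1 (suc n) 0≤ι kι≈1 (2mι≤1 n n₀≤1+n) (2ι≤1 n n₀≤1+n) P? tail)
    where
    K = fromℕ 6 * (fromℕ m * fromℕ m)
    0≤K = *-nonneg (fromℕ-nonneg 6) (*-nonneg (fromℕ-nonneg m) (fromℕ-nonneg m))
    -- The three summands of `n₀` secure `K ι ≤ ½`, `2 m ι ≤ 1` and `2 ι ≤ 1` respectively.
    K₀ n₀ : ℕ
    K₀ = 2 ℕ.* (6 ℕ.* (m ℕ.* m))
    n₀ = K₀ ℕ.+ (m ℕ.* 2 ℕ.+ 2)

    1+1≈2 : 1# + 1# ≈ fromℕ 2
    1+1≈2 = +-congˡ (sym (+-identityʳ 1#))

    2mι≤1 : ∀ n → n₀ ℕ.≤ suc n → fromℕ m * ((1# + 1#) * 1/[1+ n ]) ≤ 1#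
    2mι≤1 n n₀≤ = ≤-trans
      (≤-reflexive (trans (sym (*-assoc _ _ _)) (*-congʳ (trans (*-congˡ 1+1≈2) (sym (fromℕ-* m 2))))))
      (m/[1+n]≤1 (ℕ.≤-trans (ℕ.≤-trans (ℕ.m≤m+n (m ℕ.* 2) 2) (ℕ.m≤n+m _ K₀)) n₀≤))

    2ι≤1 : ∀ n → n₀ ℕ.≤ suc n → (1# + 1#) * 1/[1+ n ] ≤ 1#
    2ι≤1 n n₀≤ = ≤-trans (≤-reflexive (*-congʳ 1+1≈2))
      (m/[1+n]≤1 (ℕ.≤-trans (ℕ.≤-trans (ℕ.m≤n+m 2 (m ℕ.* 2)) (ℕ.m≤n+m _ K₀)) n₀≤))

    Kι≤½ : ∀ n → n₀ ℕ.≤ suc n → K * 1/[1+ n ] ≤ ½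
    Kι≤½ n n₀≤ = begin
      K * 1/[1+ n ]                        ≈⟨ ½*[2*x]≈x _ ⟨
      ½ * (fromℕ 2 * (K * 1/[1+ n ]))      ≈⟨ *-congˡ (trans (sym (*-assoc _ _ _)) (*-congʳ (trans (*-congˡ (trans (*-congˡ (sym (fromℕ-* m m))) (sym (fromℕ-* 6 (m ℕ.* m))))) (sym (fromℕ-* 2 (6 ℕ.* (m ℕ.* m))))))) ⟩
      ½ * (fromℕ K₀ * 1/[1+ n ])           ≤⟨ *-monoˡ-≤ 0≤½ (m/[1+n]≤1 (ℕ.≤-trans (ℕ.m≤m+n K₀ _) n₀≤)) ⟩
      ½ * 1#                               ≈⟨ *-identityʳ ½ ⟩
      ½                                    ∎

  2/δ≰1 : ∀ {δ} → 0# < δ → δ < 1# → ¬ fromℕ 2 / δ ≤ 1#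
  2/δ≰1 {δ} 0<δ δ<1 2/δ≤1 = <⇒≱ δ<1 (begin
    1#                 ≤⟨ ≤-byDifference (fromℕ-nonneg 1) refl ⟩
    fromℕ 2            ≈⟨ trans (*-assoc _ _ _) (trans (*-congˡ (trans (*-comm _ _) (⁻¹-inverse 0<δ))) (*-identityʳ _)) ⟨
    fromℕ 2 / δ * δ    ≤⟨ *-monoʳ-≤ (proj₁ 0<δ) 2/δ≤1 ⟩
    1# * δ             ≈⟨ *-identityˡ δ ⟩
    δ                  ∎)

  2/δ≤2/q⇒q≤δ : ∀ {δ q} → 0# < δ → 0# < q → fromℕ 2 / δ ≤ fromℕ 2 / q → q ≤ δ
  2/δ≤2/q⇒q≤δ {δ} {q} 0<δ 0<q 2/δ≤2/q = *-cancelˡ-≤ (fromℕ-pos 1) (begin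
    fromℕ 2 * q                 ≈⟨ *-congˡ (trans (*-congʳ (⁻¹-inverse 0<δ)) (*-identityˡ q)) ⟨
    fromℕ 2 * (δ * δ ⁻¹ * q)    ≈⟨ solve 4 (λ t d r q → t :* (d :* r :* q) := d :* q :* (t :* r)) refl (fromℕ 2) δ (δ ⁻¹) q ⟩
    δ * q * (fromℕ 2 / δ)       ≤⟨ *-monoˡ-≤ (*-nonneg (proj₁ 0<δ) (proj₁ 0<q)) 2/δ≤2/q ⟩
    δ * q * (fromℕ 2 / q)       ≈⟨ solve 4 (λ t d r q → d :* q :* (t :* r) := t :* (q :* r :* d)) refl (fromℕ 2) δ (q ⁻¹) q ⟩
    fromℕ 2 * (q * q ⁻¹ * δ)    ≈⟨ *-congˡ (trans (*-congʳ (⁻¹-inverse 0<q)) (*-identityˡ δ)) ⟩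
    fromℕ 2 * δ                 ∎)

  sample-size : ∀ {ε L} m → 0# < ε → fromℕ 2 / (ε ^ 2) * L ≤ fromℕ m → L ≤ fromℕ m * (½ * (ε * ε))
  sample-size {ε} {L} m 0<ε 2L/ε²≤m = begin
    L
      ≈⟨ ½*[2*x]≈x L ⟨
    ½ * (fromℕ 2 * L)
      ≈⟨ *-congˡ (trans (*-congʳ (⁻¹-inverse 0<ε²)) (*-identityˡ _)) ⟨
    ½ * (ε ^ 2 * (ε ^ 2) ⁻¹ * (fromℕ 2 * L))
      ≈⟨ solve 5 (λ h e r t l → h :* (e :* (e :* con (+ 1)) :* r :* (t :* l)) := t :* r :* l :* (h :* (e :* e))) refl ½ ε ((ε ^ 2) ⁻¹) (fromℕ 2) L ⟩
    fromℕ 2 / (ε ^ 2) * L * (½ * (ε * ε))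
      ≤⟨ *-monoʳ-≤ (*-nonneg 0≤½ (square-nonneg ε)) 2L/ε²≤m ⟩
    fromℕ m * (½ * (ε * ε)) ∎
    where
    0<ε² : 0# < ε ^ 2
    0<ε² = *-pos 0<ε (*-pos 0<ε (0≤1 , 0≉1))

  abs≰⇒tail : ∀ {x y} → ¬ abs x ≤ y → (y ≤ x) ⊎ (y ≤ - x)
  abs≰⇒tail {x} {y} ∣x∣≰y with total y x | total y (- x)
  ... | inj₁ y≤x | _         = inj₁ y≤x
  ... | inj₂ x≤y | inj₁ y≤-x = inj₂ y≤-x
  ... | inj₂ x≤y | inj₂ -x≤y = ⊥-elim (∣x∣≰y (abs-lub x≤y -x≤y))

  -- Application to the silhouette of a nonempty dataset.

  module _ {u ℓ} (U : MetricSpace ℝ u ℓ) {n k : ℕ} (V : Dataset ℝ U (suc n)) (𝒞 : Clustering (suc n) k) where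

    open Silhouette ℝ V 𝒞
    open SilhouetteRange ℝ V 𝒞

    private
      p : Vector Carrier (suc n)
      p = uniform ℝ (suc n)

    uniform-nonneg : ∀ i → 0# ≤ p i
    uniform-nonneg i = /-nonneg 0≤1 (fromℕ-nonneg (suc n))

    sum-uniform : sum p ≈ 1#
    sum-uniform = trans (sum-const (suc n) _) (trans (*-congˡ (*-identityˡ _)) (⁻¹-inverse (fromℕ-pos n)))

    s-within : ∀ e → Within 1# (s e)
    s-within e = ≤-trans (-‿anti-≤ (≤-trans (-x≤abs (s e)) (abs-s≤1 e))) (≤-reflexive (solve 1 (λ x → :- :- x := x) refl (s e)))
               , ≤-trans (x≤abs (s e)) (abs-s≤1 e)

    mean≈silhouette : sum (λ i → p i * s i) ≈ silhouette
    mean≈silhouette = trans (sym (*-distribˡ-sum (1# / fromℕ (suc n)) s))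
      (trans (*-congʳ (*-identityˡ _)) (*-comm _ _))

    deviation≈ : ∀ m ω → deviation p s uniform-nonneg sum-uniform s-within (suc m) ω ≈ fromℕ (suc m) * (estimate ω - silhouette)
    deviation≈ m ω = begin-equality
      sum (λ l → s (ω l) - sum (λ i → p i * s i))
        ≈⟨ ∑-distrib-+ (λ l → s (ω l)) (λ _ → - sum (λ i → p i * s i)) ⟩
      sum (λ l → s (ω l)) + sum {suc m} (λ _ → - sum (λ i → p i * s i))
        ≈⟨ +-cong (trans (sym (*-identityʳ _)) (*-congˡ (sym (⁻¹-inverse (fromℕ-pos m)))))
             (trans (sum-const (suc m) _) (*-congˡ (-‿cong mean≈silhouette))) ⟩
      sum (λ l → s (ω l)) * (fromℕ (suc m) * fromℕ (suc m) ⁻¹) + fromℕ (suc m) * - silhouette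
        ≈⟨ solve 4 (λ x m r y → x :* (m :* r) :+ m :* :- y := m :* (x :* r :- y)) refl _ (fromℕ (suc m)) _ silhouette ⟩
      fromℕ (suc m) * (estimate ω - silhouette) ∎

    estimate-accurate : (ε δ : Carrier) → 0# < ε → ε < 1# → 0# < δ → δ < 1# →
      (m : ℕ) (L : Carrier) → IsLn (fromℕ 2 / δ) L → (fromℕ 2 / (ε ^ 2)) * L ≤ fromℕ m →
      1# - δ ≤ Pr ℝ p m (λ ω → abs (estimate ω - silhouette) ≤? ε)
    estimate-accurate ε δ 0<ε ε<1 0<δ δ<1 m L ln 2L/ε²≤m = go m (sample-size m 0<ε 2L/ε²≤m)
      where
      L≰0 : ¬ L ≤ 0#
      L≰0 L≤0 = 2/δ≰1 0<δ δ<1 (x≤0⇒exp≤1 ln L≤0)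

      go : ∀ m → L ≤ fromℕ m * (½ * (ε * ε)) → 1# - δ ≤ Pr ℝ p m (λ ω → abs (estimate ω - silhouette) ≤? ε)
      -- Without samples the size condition would force `L ≤ 0#`; in the other case the division by
      -- `m` in `estimate` is a genuine one.
      go zero    L≤ = ⊥-elim (L≰0 (≤-trans L≤ (≤-reflexive (zeroˡ _))))
      go (suc m) L≤ = ≤-byDifference (x≤y⇒0≤y-x q≤δ)
        (solve 2 (λ d P → con (+ 1) :- d :+ (d :- (con (+ 1) :- P)) := P) refl δ prob)
        where
        P? = λ (ω : Fin (suc m) → Fin (suc n)) → abs (estimate ω - silhouette) ≤? ε
        prob q : Carrier
        prob = Pr ℝ p (suc m) P?
        q = 1# - prob

        tail : ∀ ω → ¬ abs (estimate ω - silhouette) ≤ ε →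
          let D = deviation p s uniform-nonneg sum-uniform s-within (suc m) ω in
          (fromℕ (suc m) * ε ≤ D) ⊎ (fromℕ (suc m) * ε ≤ - D)
        tail ω far with abs≰⇒tail far
        ... | inj₁ ε≤x  = inj₁ (≤-trans (*-monoˡ-≤ (fromℕ-nonneg (suc m)) ε≤x) (≤-reflexive (sym (deviation≈ m ω))))
        ... | inj₂ ε≤-x = inj₂ (≤-trans (*-monoˡ-≤ (fromℕ-nonneg (suc m)) ε≤-x)
          (≤-reflexive (trans (solve 2 (λ m x → m :* :- x := :- (m :* x)) refl (fromℕ (suc m)) _) (-‿cong (sym (deviation≈ m ω))))))

        q≤δ : q ≤ δ
        -- Arguing by contradiction supplies `q > δ > 0`, and with it the positivity required for
        -- dividing by `q`.
        q≤δ = ≤-stable λ q≰δ →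
          let 0<q = ≰⇒> λ q≤0 → q≰δ (≤-trans q≤0 (proj₁ 0<δ)) in
          q≰δ (2/δ≤2/q⇒q≤δ 0<δ 0<q
            (hoeffding p s uniform-nonneg sum-uniform s-within (suc m) (proj₁ 0<ε) (proj₁ ε<1) P? tail ln (≰⇒≥ L≰0) L≤ 0<q))

theorem3 : ∀ {c ℓ₁ ℓ₂ u ℓ} (ℝ : Reals c ℓ₁ ℓ₂) → let open Reals ℝ in
    (U : MetricSpace ℝ u ℓ) {n k : ℕ} (V : Dataset ℝ U n) (𝒞 : Clustering n k) →
    let open Silhouette ℝ V 𝒞 in
    (ε δ : Carrier) → 0# < ε → ε < 1# → 0# < δ → δ < 1# →
    (m : ℕ) (L : Carrier) → IsLn (fromℕ 2 / δ) L →
    (fromℕ 2 / (ε ^ 2)) * L ≤ fromℕ m →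
    1# - δ ≤ Pr ℝ (uniform ℝ n) m (λ ω → abs (estimate ω - silhouette) ≤? ε)
theorem3 ℝ U {suc n} V 𝒞 = estimate-accurate ℝ U V 𝒞
-- An empty dataset has no clustering: `2 ≤ k` provides a cluster, and its element would be an index
-- in `Fin 0`.
theorem3 ℝ U {zero}  V 𝒞 with () ← proj₁ (Clustering.nonempty 𝒞 (Fin.fromℕ< (ℕ.≤-trans (s≤s z≤n) (Clustering.2≤k 𝒞))))
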